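{- Let $d$ and $k$ be positive integers. Every $n$-vertex graph in the class $k^d_{\mathrm{DIR}}\text{ -CONV}$ has at most $n^{d\cdot k^{d+1}}$ (inclusion-wise) maximal cliques.
   Context: All graphs are finite and nonempty. For a finite collection $R$ of sets, its intersection graph has one vertex for each member of $R$, and two distinct vertices are adjacent iff the corresponding sets have nonempty intersection. For a set $L$ of $k$ distinct $(d-1)$-dimensional hyperplanes in $\mathbb{R}^d$ containing the origin, $\mathcal{P}^d(L)$ is the set of all $d$-dimensional convex polytopes in $\mathbb{R}^d$ each of whose facets ($(d-1)$-dimensional faces) is parallel to one of the hyperplanes in $L$. The class $k^d_{\mathrm{DIR}(L)}\text{ -CONV}$ consists of all intersection graphs of finite collections of polytopes in $\mathcal{P}^d(L)$, and $k^d_{\mathrm{DIR}}\text{ -CONV}$ is the union of $k^d_{\mathrm{DIR}(L)}\text{ -CONV}$ over all sets $L$ of $k$ distinct hyperplanes through the origin in $\mathbb{R}^d$. -}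

module Defs where

open import Data.Fin.Base using (Fin)
open import Data.Fin.Subset using (Subset; _∈_; _⊆_)
open import Data.Nat.Base as ℕ using (ℕ; suc; _∸_)
import Data.Nat.Properties as ℕ
open import Data.Product.Base using (Σ; ∃; ∃-syntax; _×_; _,_)
open import Data.Rational.Base as ℚ using (ℚ; 0ℚ; 1ℚ; ½; ∣_∣; Positive; positive; 1/_)
import Data.Rational.Properties as ℚ
open import Data.Rational.Solver using (module +-*-Solver)
open import Data.Vec.Functional using (Vector; foldr)
open import Function.Bundles using (_⇔_)
open import Level using (0ℓ)
open import Relation.Binary.Core using (Rel)
open import Relation.Binary.Definitions using (Symmetric; Irreflexive)
open import Relation.Binary.PropositionalEquality
  using (_≡_; _≢_; refl; sym; trans; cong; subst)
open import Relation.Nullary.Negation.Core using (¬_)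
open import Relation.Unary as U using (Pred; _≐_; _≬_)

------------------------------------------------------------------------
-- Real numbers: Cauchy sequences of rationals, compared up to _≈_

IsCauchy : (ℕ → ℚ) → Set
IsCauchy x = ∀ ε → 0ℚ ℚ.< ε →
  ∃[ N ] (∀ m n → N ℕ.≤ m → N ℕ.≤ n → ∣ x m ℚ.- x n ∣ ℚ.< ε)

record ℝ : Set where
  constructor mkℝ
  field
    seq    : ℕ → ℚ
    cauchy : IsCauchy seq

open ℝ public

Eventually : Pred ℕ 0ℓ → Set
Eventually P = ∃[ N ] (∀ n → N ℕ.≤ n → P n)

infix 4 _≈_ _≤_

record _≈_ (x y : ℝ) : Set where
  constructor mk≈
  field
    close : ∀ ε → 0ℚ ℚ.< ε → Eventually λ n → ∣ seq x n ℚ.- seq y n ∣ ℚ.< ε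

record _≤_ (x y : ℝ) : Set where
  constructor mk≤
  field
    below : ∀ ε → 0ℚ ℚ.< ε → Eventually λ n → seq x n ℚ.≤ seq y n ℚ.+ ε

open _≈_ public
open _≤_ public

abstract
  const-cauchy : ∀ q → IsCauchy (λ _ → q)
  const-cauchy q ε 0<ε = 0 , λ _ _ _ _ →
    subst (λ z → ∣ z ∣ ℚ.< ε) (sym (ℚ.+-inverseʳ q)) 0<ε

  neg-cauchy : ∀ x → IsCauchy x → IsCauchy (λ n → ℚ.- x n)
  neg-cauchy x cx ε 0<ε with cx ε 0<ε
  ... | N , h = N , λ m n N≤m N≤n →
    subst (ℚ._< ε)
      (trans (sym (ℚ.∣-p∣≡∣p∣ (x m ℚ.- x n)))
             (cong ∣_∣ (ℚ.neg-distrib-+ (x m) (ℚ.- x n))))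
      (h m n N≤m N≤n)

  ½*-pos : ∀ {ε} → 0ℚ ℚ.< ε → 0ℚ ℚ.< ½ ℚ.* ε
  ½*-pos {ε} 0<ε = ℚ.positive⁻¹ (½ ℚ.* ε) {{ℚ.pos*pos⇒pos ½ ε {{positive 0<ε}}}}

  ½+½ : ∀ ε → ½ ℚ.* ε ℚ.+ ½ ℚ.* ε ≡ ε
  ½+½ ε = trans (sym (ℚ.*-distribʳ-+ ε ½ ½)) (ℚ.*-identityˡ ε)

  +-cauchy : ∀ x y → IsCauchy x → IsCauchy y → IsCauchy (λ n → x n ℚ.+ y n)
  +-cauchy x y cx cy ε 0<ε
    with cx (½ ℚ.* ε) (½*-pos 0<ε) | cy (½ ℚ.* ε) (½*-pos 0<ε)
  ... | M , h | N , k = M ℕ.⊔ N , λ m n ≤m ≤n → begin-strict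
    ∣ (x m ℚ.+ y m) ℚ.- (x n ℚ.+ y n) ∣
      ≡⟨ cong ∣_∣ (regroup (x m) (y m) (x n) (y n)) ⟩
    ∣ (x m ℚ.- x n) ℚ.+ (y m ℚ.- y n) ∣
      ≤⟨ ℚ.∣p+q∣≤∣p∣+∣q∣ (x m ℚ.- x n) (y m ℚ.- y n) ⟩
    ∣ x m ℚ.- x n ∣ ℚ.+ ∣ y m ℚ.- y n ∣
      <⟨ ℚ.+-mono-<
           (h m n (ℕ.m⊔n≤o⇒m≤o M N ≤m) (ℕ.m⊔n≤o⇒m≤o M N ≤n))
           (k m n (ℕ.m⊔n≤o⇒n≤o M N ≤m) (ℕ.m⊔n≤o⇒n≤o M N ≤n)) ⟩
    ½ ℚ.* ε ℚ.+ ½ ℚ.* ε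
      ≡⟨ ½+½ ε ⟩
    ε ∎
    where
    open ℚ.≤-Reasoning
    open +-*-Solver
    regroup : ∀ a b c d → (a ℚ.+ b) ℚ.- (c ℚ.+ d) ≡ (a ℚ.- c) ℚ.+ (b ℚ.- d)
    regroup = solve 4 (λ a b c d → (a :+ b) :- (c :+ d) := (a :- c) :+ (b :- d)) refl

  bounded : ∀ x → IsCauchy x →
    ∃[ K ] (0ℚ ℚ.< K × Eventually λ n → ∣ x n ∣ ℚ.< K)
  bounded x cx with cx 1ℚ (ℚ.positive⁻¹ 1ℚ)
  ... | N , h = ∣ x N ∣ ℚ.+ 1ℚ , 0<K , N , λ n N≤n → begin-strict
    ∣ x n ∣
      ≡⟨ cong ∣_∣ (split (x n) (x N)) ⟩
    ∣ x N ℚ.+ (x n ℚ.- x N) ∣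
      ≤⟨ ℚ.∣p+q∣≤∣p∣+∣q∣ (x N) (x n ℚ.- x N) ⟩
    ∣ x N ∣ ℚ.+ ∣ x n ℚ.- x N ∣
      <⟨ ℚ.+-monoʳ-< ∣ x N ∣ (h n N N≤n ℕ.≤-refl) ⟩
    ∣ x N ∣ ℚ.+ 1ℚ ∎
    where
    open ℚ.≤-Reasoning
    open +-*-Solver
    0<K : 0ℚ ℚ.< ∣ x N ∣ ℚ.+ 1ℚ
    0<K = ℚ.+-mono-≤-< (ℚ.0≤∣p∣ (x N)) (ℚ.positive⁻¹ 1ℚ)
    split : ∀ a b → a ≡ b ℚ.+ (a ℚ.- b)
    split = solve 2 (λ a b → a := b :+ (a :- b)) refl

  ∣pq∣<Kδ : ∀ {p q K δ} → 0ℚ ℚ.< K → ∣ p ∣ ℚ.< K → ∣ q ∣ ℚ.< δ → ∣ p ℚ.* q ∣ ℚ.< K ℚ.* δ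
  ∣pq∣<Kδ {p} {q} {K} {δ} 0<K p<K q<δ = begin-strict
    ∣ p ℚ.* q ∣       ≡⟨ ℚ.∣p*q∣≡∣p∣*∣q∣ p q ⟩
    ∣ p ∣ ℚ.* ∣ q ∣   ≤⟨ ℚ.*-monoʳ-≤-nonNeg ∣ q ∣ {{ℚ.∣-∣-nonNeg q}} (ℚ.<⇒≤ p<K) ⟩
    K ℚ.* ∣ q ∣       <⟨ ℚ.*-monoʳ-<-pos K {{positive 0<K}} q<δ ⟩
    K ℚ.* δ           ∎
    where open ℚ.≤-Reasoning

  *-diff : ∀ {K L δ} → 0ℚ ℚ.< K → 0ℚ ℚ.< L → ∀ a b c d →
    ∣ a ∣ ℚ.< K → ∣ d ∣ ℚ.< L → ∣ a ℚ.- c ∣ ℚ.< δ → ∣ b ℚ.- d ∣ ℚ.< δ →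
    ∣ a ℚ.* b ℚ.- c ℚ.* d ∣ ℚ.< (K ℚ.+ L) ℚ.* δ
  *-diff {K} {L} {δ} 0<K 0<L a b c d a<K d<L ac<δ bd<δ = begin-strict
    ∣ a ℚ.* b ℚ.- c ℚ.* d ∣
      ≡⟨ cong ∣_∣ (regroup a b c d) ⟩
    ∣ a ℚ.* (b ℚ.- d) ℚ.+ d ℚ.* (a ℚ.- c) ∣
      ≤⟨ ℚ.∣p+q∣≤∣p∣+∣q∣ (a ℚ.* (b ℚ.- d)) (d ℚ.* (a ℚ.- c)) ⟩
    ∣ a ℚ.* (b ℚ.- d) ∣ ℚ.+ ∣ d ℚ.* (a ℚ.- c) ∣
      <⟨ ℚ.+-mono-< (∣pq∣<Kδ 0<K a<K bd<δ) (∣pq∣<Kδ 0<L d<L ac<δ) ⟩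
    K ℚ.* δ ℚ.+ L ℚ.* δ
      ≡⟨ sym (ℚ.*-distribʳ-+ δ K L) ⟩
    (K ℚ.+ L) ℚ.* δ ∎
    where
    open ℚ.≤-Reasoning
    open +-*-Solver
    regroup : ∀ a b c d → a ℚ.* b ℚ.- c ℚ.* d ≡ a ℚ.* (b ℚ.- d) ℚ.+ d ℚ.* (a ℚ.- c)
    regroup = solve 4 (λ a b c d → a :* b :- c :* d := a :* (b :- d) :+ d :* (a :- c)) refl

  shrink : ∀ {M ε} → 0ℚ ℚ.< M → 0ℚ ℚ.< ε → ∃[ δ ] (0ℚ ℚ.< δ × M ℚ.* δ ≡ ε)
  shrink {M} {ε} 0<M 0<ε = 1/ M ℚ.* ε , 0<δ ,
    trans (sym (ℚ.*-assoc M (1/ M) ε))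
      (trans (cong (ℚ._* ε) (ℚ.*-inverseʳ M)) (ℚ.*-identityˡ ε))
    where
    instance
      M-pos : Positive M
      M-pos = positive 0<M
      M-nonZero : ℚ.NonZero M
      M-nonZero = ℚ.pos⇒nonZero M
    0<δ : 0ℚ ℚ.< 1/ M ℚ.* ε
    0<δ = ℚ.positive⁻¹ (1/ M ℚ.* ε)
      {{ℚ.pos*pos⇒pos (1/ M) {{ℚ.1/pos⇒pos M}} ε {{positive 0<ε}}}}

  *-cauchy : ∀ x y → IsCauchy x → IsCauchy y → IsCauchy (λ n → x n ℚ.* y n)
  *-cauchy x y cx cy ε 0<ε =
    let K , 0<K , A , bx = bounded x cx
        L , 0<L , B , by = bounded y cy
        δ , 0<δ , eq     = shrink (ℚ.+-mono-< 0<K 0<L) 0<ε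
        M , h            = cx δ 0<δ
        N , k            = cy δ 0<δ
    in (A ℕ.⊔ B) ℕ.⊔ (M ℕ.⊔ N) , λ m n ≤m ≤n →
      let A⊔B≤m = ℕ.m⊔n≤o⇒m≤o (A ℕ.⊔ B) (M ℕ.⊔ N) ≤m
          A⊔B≤n = ℕ.m⊔n≤o⇒m≤o (A ℕ.⊔ B) (M ℕ.⊔ N) ≤n
          M⊔N≤m = ℕ.m⊔n≤o⇒n≤o (A ℕ.⊔ B) (M ℕ.⊔ N) ≤m
          M⊔N≤n = ℕ.m⊔n≤o⇒n≤o (A ℕ.⊔ B) (M ℕ.⊔ N) ≤n
      in subst (∣ x m ℚ.* y m ℚ.- x n ℚ.* y n ∣ ℚ.<_) eq
           (*-diff 0<K 0<L (x m) (y m) (x n) (y n)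
             (bx m (ℕ.m⊔n≤o⇒m≤o A B A⊔B≤m))
             (by n (ℕ.m⊔n≤o⇒n≤o A B A⊔B≤n))
             (h m n (ℕ.m⊔n≤o⇒m≤o M N M⊔N≤m) (ℕ.m⊔n≤o⇒m≤o M N M⊔N≤n))
             (k m n (ℕ.m⊔n≤o⇒n≤o M N M⊔N≤m) (ℕ.m⊔n≤o⇒n≤o M N M⊔N≤n)))

infixl 7 _*_
infixl 6 _+_ _-_
infix  8 -_

0ℝ : ℝ
0ℝ = mkℝ (λ _ → 0ℚ) (const-cauchy 0ℚ)

-_ : ℝ → ℝ
- x = mkℝ (λ n → ℚ.- seq x n) (neg-cauchy (seq x) (cauchy x))

_+_ _-_ _*_ : ℝ → ℝ → ℝ
x + y = mkℝ (λ n → seq x n ℚ.+ seq y n) (+-cauchy (seq x) (seq y) (cauchy x) (cauchy y))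
x - y = x + (- y)
x * y = mkℝ (λ n → seq x n ℚ.* seq y n) (*-cauchy (seq x) (seq y) (cauchy x) (cauchy y))

∑ : ∀ {m} → Vector ℝ m → ℝ
∑ = foldr _+_ 0ℝ

------------------------------------------------------------------------
-- Euclidean space

ℝ^ : ℕ → Set
ℝ^ d = Vector ℝ d

PointSet : ℕ → Set₁
PointSet d = Pred (ℝ^ d) 0ℓ

module _ {d : ℕ} where

  infixl 6 _⊖_
  infix  7 _·_

  _⊖_ : ℝ^ d → ℝ^ d → ℝ^ d
  (x ⊖ y) i = x i - y i

  _·_ : ℝ^ d → ℝ^ d → ℝ
  a · x = ∑ λ i → a i * x i

  IsZero : ℝ^ d → Set
  IsZero x = ∀ i → x i ≈ 0ℝ

  AffinelyIndependent : ∀ {m} → (Fin m → ℝ^ d) → Set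
  AffinelyIndependent p = ∀ c → ∑ c ≈ 0ℝ → IsZero (λ i → ∑ λ j → c j * p j i) →
    ∀ j → c j ≈ 0ℝ

  -- The affine hull of S has dimension m: S contains m+1 affinely independent
  -- points, but not m+2.
  HasDimension : PointSet d → ℕ → Set
  HasDimension S m =
    (∃[ p ] ((∀ j → p j U.∈ S) × AffinelyIndependent {suc m} p)) ×
    (∀ p → (∀ j → p j U.∈ S) → ¬ AffinelyIndependent {suc (suc m)} p)

  IsLinearHyperplane : PointSet d → Set
  IsLinearHyperplane H = ∃[ a ] (¬ IsZero a × H ≐ λ x → a · x ≈ 0ℝ)

  IsClosedHalfspace : PointSet d → Set
  IsClosedHalfspace S = ∃[ a ] ∃[ b ] (¬ IsZero a × S ≐ λ x → a · x ≤ b)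

  IsBounded : PointSet d → Set
  IsBounded S = ∃[ M ] (∀ {x} → x U.∈ S → ∀ i → - M ≤ x i × x i ≤ M)

  IsConvexPolytope : PointSet d → Set₁
  IsConvexPolytope P =
    (∃[ m ] Σ (Fin m → PointSet d) λ S →
      (∀ j → IsClosedHalfspace (S j)) × P ≐ U.⋂ (Fin m) S) ×
    IsBounded P

  IsFace : PointSet d → PointSet d → Set
  IsFace P F = ∃[ a ] ∃[ b ]
    ((∀ {x} → x U.∈ P → a · x ≤ b) × F ≐ λ x → x U.∈ P × a · x ≈ b)

  IsFacet : PointSet d → PointSet d → Set
  IsFacet P F = IsFace P F × HasDimension F (d ∸ 1)

  -- F lies in a translate of H; when F is (d-1)-dimensional and H is a
  -- hyperplane, this translate is the affine hull of F.
  _∥_ : PointSet d → PointSet d → Set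
  F ∥ H = ∀ {x y} → x U.∈ F → y U.∈ F → (x ⊖ y) U.∈ H

  𝒫 : ∀ {k} → (Fin k → PointSet d) → PointSet d → Set₁
  𝒫 L P = IsConvexPolytope P × HasDimension P d ×
    (∀ F → IsFacet P F → ∃[ i ] F ∥ L i)

------------------------------------------------------------------------
-- Graphs

record Graph (n : ℕ) : Set₁ where
  infix 4 _~_
  field
    _~_    : Rel (Fin n) 0ℓ
    symm   : Symmetric _~_
    irrefl : Irreflexive _≡_ _~_

module _ {n : ℕ} (G : Graph n) where
  open Graph G

  IsIntersectionGraphOf : ∀ {d} → (Fin n → PointSet d) → Set
  IsIntersectionGraphOf R = ∀ {u v} → u ≢ v → (u ~ v) ⇔ (R u ≬ R v)

  DIR-CONV : ∀ {d k} → (Fin k → PointSet d) → Set₁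
  DIR-CONV {d} L = Σ (Fin n → PointSet d) λ R →
    (∀ v → 𝒫 L (R v)) × IsIntersectionGraphOf R

  -- Membership of G in the class, up to naming the vertices by Fin n; the
  -- collection is a family, so a polytope may occur at several vertices.
  k-DIR-CONV : (d k : ℕ) → Set₁
  k-DIR-CONV d k = Σ (Fin k → PointSet d) λ L →
    (∀ i → IsLinearHyperplane (L i)) ×
    (∀ {i j} → i ≢ j → ¬ (L i ≐ L j)) ×
    DIR-CONV L

  IsClique : Subset n → Set
  IsClique C = ∀ {u v} → u ∈ C → v ∈ C → u ≢ v → u ~ v

  IsMaximalClique : Subset n → Set
  IsMaximalClique C = IsClique C × (∀ D → IsClique D → C ⊆ D → C ≡ D)

{-# OPTIONS --safe #-}

-- The bound is decidable, so one may argue classically in the double-negation monad.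
--
-- Discarding redundant constraints, each polytope is an intersection of halfspaces whose normals
-- are multiples of the k given ones: an irredundant constraint defines a facet. If P and Q are
-- disjoint, Farkas' lemma gives a vanishing combination of normals, some taken from P and some
-- from Q, that contradicts the bounds. A combination of minimal support is a circuit, so it
-- involves at most d + 1 normals, and the part u of it that comes from P separates P and Q. The
-- circuit property says that the span of the normals taken from P and the span of those taken
-- from Q meet in the line of u. Hence u is determined, up to a scalar, by a tuple of d + 1
-- indices of normals and by the number, between 1 and d, of those belonging to P: there are D =
-- d · k^(d+1) candidate directions, independent of the polytopes.
--
-- Two polytopes thus intersect iff their projections to all D directions do. In each direction
-- the rightmost of the left endpoints of a clique belongs to all of its intervals, and a
-- maximal clique is determined by the D members that attain it, which gives the bound n^D.

module Submission where

open import Defs using (Graph; IsClique; IsMaximalClique)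

open import Algebra.Bundles using (CommutativeRing)
open import Algebra.Solver.Ring.AlmostCommutativeRing using (AlmostCommutativeRing; fromCommutativeRing; _-Raw-AlmostCommutative⟶_)
open import Algebra.Structures using (IsCommutativeRing)
open import Data.Fin.Base as Fin using (Fin; zero; suc; toℕ; fromℕ<; punchIn; punchOut; splitAt; _↑ˡ_; _↑ʳ_; remQuot; combine; finToFun; funToFin)
import Data.Fin.Properties as Fin
open import Data.Fin.Subset using (Subset; _∈_; _∪_; ⁅_⁆; Nonempty)
open import Data.Fin.Subset.Properties using (nonempty?; p⊆p∪q; q⊆p∪q; x∈p∪q⁻; x∈⁅x⁆; x∈⁅y⁆⇒x≡y)
open import Data.List.Base as List using (List; []; _∷_; _++_; length; lookup; cartesianProductWith)
import Data.List.Membership.Propositional as List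
open import Data.List.Membership.Propositional.Properties using (∈-lookup; ∈-cartesianProductWith⁺; ∈-cartesianProductWith⁻)
open import Data.List.Relation.Unary.All as All using (All; []; _∷_)
import Data.List.Relation.Unary.All.Properties as All
open import Data.List.Relation.Unary.AllPairs using (_∷_)
open import Data.List.Relation.Unary.Any using (here; there)
open import Data.List.Relation.Unary.Unique.Propositional using (Unique)
open import Data.Maybe.Base using (just; nothing)
open import Data.Nat.Base as ℕ using (ℕ; zero; suc; z≤n; s≤s; NonZero; _^_) renaming (_≤_ to _≤ℕ_; _+_ to _+ℕ_; _*_ to _*ℕ_)
import Data.Nat.Properties as ℕ
open import Data.Product.Base using (Σ; ∃; ∃-syntax; _×_; _,_; proj₁; proj₂; uncurry)
open import Data.Rational.Base as ℚ using (ℚ; 0ℚ; 1ℚ; ½; ∣_∣; positive; 1/_)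
import Data.Rational.Properties as ℚ
import Data.Rational.Solver as ℚ
open import Data.Sum.Base using (_⊎_; inj₁; inj₂; [_,_]′)
open import Data.Sum.Properties using (inj₁-injective; inj₂-injective)
import Data.Vec.Functional as V
open import Function.Base using (_∘_; id)
open import Function.Bundles using (_⇔_; Equivalence)
open import Level using (0ℓ)
open import Relation.Binary.PropositionalEquality as ≡ using (_≡_; _≢_)
open import Relation.Nullary using (Dec; yes; no; ¬_; contradiction)
open import Relation.Nullary.Decidable using (decidable-stable; ¬¬-excluded-middle)
open import Relation.Unary using (_≬_)


-- Signs of Cauchy reals are undecidable and reciprocals exist only under double negation, so pivots
-- and chosen points live in that monad; every family of choices is indexed by a finite type, over
-- which double negation commutes with "for all".
--
-- A polytope may be bounded on both sides along one normal. Constraints with proportional normals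
-- are therefore merged: a certificate has one signed coefficient `c j` per normal, and a threshold
-- `ρ j` that is valid for that sign only. This is why shrinking the support must preserve signs: a
-- flipped coefficient would call for a bound on the other side.
--
-- The coefficients depend on the pair of polytopes, whereas the directions must be fixed
-- beforehand. Only the line of u is canonical. It is described by two spans, which ignore order and
-- repetition, so short tuples may be padded. Both polytopes contribute a normal, since otherwise u
-- would be zero and could not separate nonempty sets; hence the range from 1 to d.
--
-- Endpoints of projections are never formed. Separation in one direction is an interval order, and
-- inclusion of sets of predecessors compares left endpoints.

infixl 1 _>>=_

_>>=_ : ∀ {a b} {A : Set a} {B : Set b} → ¬ ¬ A → (A → ¬ ¬ B) → ¬ ¬ B
(¬¬a >>= f) ¬b = ¬¬a λ a → f a ¬b

return : ∀ {a} {A : Set a} → A → ¬ ¬ A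
return a ¬a = ¬a a

em : ∀ {a} {A : Set a} → ¬ ¬ Dec A
em = ¬¬-excluded-middle

-- Finite choice: witnesses that exist only classically, one for each index, can be extracted
-- together and then used as a function.
¬¬∀ : ∀ {p n} {P : Fin n → Set p} → (∀ i → ¬ ¬ P i) → ¬ ¬ (∀ i → P i)
¬¬∀ {n = zero}  h = return λ ()
¬¬∀ {n = suc n} h = do
  p ← h zero
  q ← ¬¬∀ λ i → h (suc i)
  return λ { zero → p ; (suc i) → q i }

¬∀⇒¬¬∃¬ : ∀ {a p} {A : Set a} {P : A → Set p} → (∀ x → ¬ ¬ P x → P x) →
  ¬ (∀ x → P x) → ¬ ¬ (∃[ x ] ¬ P x)
¬∀⇒¬¬∃¬ stable ¬∀ ¬∃ = ¬∀ λ x → stable x λ ¬px → ¬∃ (x , ¬px)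

minimum : ∀ {n} (_⊑_ : Fin n → Fin n → Set) → (∀ i → i ⊑ i) → (∀ {i j l} → i ⊑ j → j ⊑ l → i ⊑ l) →
  (∀ i j → ¬ ¬ (i ⊑ j ⊎ j ⊑ i)) → (Q : Fin n → Set) → ∃ Q → ¬ ¬ (∃[ i ] (Q i × (∀ j → Q j → i ⊑ j)))
minimum {suc n} _⊑_ ⊑-refl ⊑-trans ⊑-total Q q = do
  yes q₊ ← em {A = ∃ (Q ∘ suc)}
    where no ¬q₊ → return (only-zero q ¬q₊)
  (i , qᵢ , i⊑) ← minimum (λ i j → suc i ⊑ suc j) (⊑-refl ∘ suc) ⊑-trans (λ i j → ⊑-total (suc i) (suc j)) (Q ∘ suc) q₊
  yes q₀ ← em {A = Q zero}
    where no ¬q₀ → return (suc i , qᵢ , λ { zero q → contradiction q ¬q₀ ; (suc j) → i⊑ j })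
  inj₁ 0⊑i ← ⊑-total zero (suc i)
    where inj₂ i⊑0 → return (suc i , qᵢ , λ { zero _ → i⊑0 ; (suc j) → i⊑ j })
  return (zero , q₀ , λ { zero _ → ⊑-refl zero ; (suc j) q → ⊑-trans 0⊑i (i⊑ j q) })
  where
  only-zero : ∃ Q → ¬ ∃ (Q ∘ suc) → ∃[ i ] (Q i × (∀ j → Q j → i ⊑ j))
  only-zero (suc i , q) ¬q₊ = contradiction (i , q) ¬q₊
  only-zero (zero  , q) ¬q₊ = zero , q , λ { zero _ → ⊑-refl zero ; (suc j) q → contradiction (j , q) ¬q₊ }

-- The axioms are weakened to what holds for Cauchy reals: the order is stable rather than
-- decidable, totality appears as `≰⇒≥`, and reciprocals exist up to double negation.
record OrderedField : Set₁ where
  infix 4 _≤_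
  field
    commutativeRing : CommutativeRing 0ℓ 0ℓ
  open CommutativeRing commutativeRing public
    hiding (zero) renaming (Carrier to F)
  field
    _≤_       : F → F → Set
    ≤-reflexive : ∀ {x y} → x ≈ y → x ≤ y
    ≤-trans   : ∀ {x y z} → x ≤ y → y ≤ z → x ≤ z
    ≤-antisym : ∀ {x y} → x ≤ y → y ≤ x → x ≈ y
    +-monoʳ-≤ : ∀ z {x y} → x ≤ y → z + x ≤ z + y
    *-nonNeg  : ∀ {x y} → 0# ≤ x → 0# ≤ y → 0# ≤ x * y
    ≤-stable  : ∀ {x y} → ¬ ¬ x ≤ y → x ≤ y
    ≰⇒≥       : ∀ {x y} → ¬ x ≤ y → y ≤ x
    inverse   : ∀ {x} → ¬ x ≈ 0# → ¬ ¬ (∃[ y ] x * y ≈ 1#)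
    1≉0       : ¬ 1# ≈ 0#
    -- Decidable coefficients for the ring solver.
    fromℚ     : ℚ.+-*-rawRing -Raw-AlmostCommutative⟶ fromCommutativeRing commutativeRing

-- Ordered fields

module Order (K : OrderedField) where
  open OrderedField K public

  private
    almost : AlmostCommutativeRing 0ℓ 0ℓ
    almost = fromCommutativeRing commutativeRing
    fromℚ-≟ : ∀ p q → _
    fromℚ-≟ p q with p ℚ.≟ q
    ... | yes p≡q = just (reflexive (≡.cong (_-Raw-AlmostCommutative⟶_.⟦_⟧ fromℚ) p≡q))
    ... | no _    = nothing

  open import Algebra.Solver.Ring ℚ.+-*-rawRing almost fromℚ fromℚ-≟ public
    using (solve; _:=_; _:+_; _:*_; _:-_; :-_; con)

  open import Algebra.Properties.Ring ring public using (-1*x≈-x; -0#≈0#; -‿involutive)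

  infix 4 _<_

  _<_ : F → F → Set
  x < y = ¬ y ≤ x

  ≤-refl : ∀ {x} → x ≤ x
  ≤-refl = ≤-reflexive refl

  <⇒≤ : ∀ {x y} → x < y → x ≤ y
  <⇒≤ = ≰⇒≥

  ≈-stable : ∀ {x y} → ¬ ¬ x ≈ y → x ≈ y
  ≈-stable h = ≤-antisym
    (≤-stable λ ¬p → h λ eq → ¬p (≤-reflexive eq))
    (≤-stable λ ¬p → h λ eq → ¬p (≤-reflexive (sym eq)))

  ≤-total : ∀ x y → ¬ ¬ (x ≤ y ⊎ y ≤ x)
  ≤-total x y = do
    yes p ← em
      where no ¬p → return (inj₂ (≰⇒≥ ¬p))
    return (inj₁ p)

  ≤-resp : ∀ {x x′ y y′} → x ≈ x′ → y ≈ y′ → x ≤ y → x′ ≤ y′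
  ≤-resp p q h = ≤-trans (≤-reflexive (sym p)) (≤-trans h (≤-reflexive q))

  ≤∧≉⇒< : ∀ {x y} → x ≤ y → x ≉ y → x < y
  ≤∧≉⇒< p n q = n (≤-antisym p q)

  ≤-<-trans : ∀ {x y z} → x ≤ y → y < z → x < z
  ≤-<-trans p q r = q (≤-trans r p)

  <-resp : ∀ {x x′ y y′} → x ≈ x′ → y ≈ y′ → x < y → x′ < y′
  <-resp p q x<y y′≤x′ = x<y (≤-resp (sym q) (sym p) y′≤x′)

  <⇒≉ : ∀ {x y} → x < y → x ≉ y
  <⇒≉ p q = p (≤-reflexive (sym q))

  +-mono-≤ : ∀ {x y u v} → x ≤ y → u ≤ v → x + u ≤ y + v
  +-mono-≤ {x} {y} {u} {v} p q = ≤-trans (+-monoʳ-≤ x q)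
    (≤-resp (+-comm v x) (+-comm v y) (+-monoʳ-≤ v p))

  x≤y⇒0≤y-x : ∀ {x y} → x ≤ y → 0# ≤ y - x
  x≤y⇒0≤y-x {x} {y} p = ≤-resp (-‿inverseˡ x) (+-comm (- x) y) (+-monoʳ-≤ (- x) p)

  -- Inequalities are proved by exhibiting y - x as a sum of products of
  -- nonnegative terms, the identity being left to the ring solver.
  from-diff : ∀ {x y t} → 0# ≤ t → y - x ≈ t → x ≤ y
  from-diff {x} {y} {t} p eq = ≤-resp (+-identityʳ x) x+t≈y (+-monoʳ-≤ x p)
    where
    x+t≈y : x + t ≈ y
    x+t≈y = trans (+-congˡ (sym eq))
      (solve 2 (λ x y → x :+ (y :- x) := y) refl x y)

  +-nonNeg : ∀ {x y} → 0# ≤ x → 0# ≤ y → 0# ≤ x + y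
  +-nonNeg p q = ≤-resp (+-identityˡ 0#) refl (+-mono-≤ p q)

  neg-nonNeg : ∀ {x} → x ≤ 0# → 0# ≤ - x
  neg-nonNeg {x} p = ≤-resp refl (+-identityˡ (- x)) (x≤y⇒0≤y-x p)

  nonNeg-neg : ∀ {x} → 0# ≤ x → - x ≤ 0#
  nonNeg-neg {x} p = ≤-resp (+-identityʳ (- x)) (-‿inverseˡ x) (+-monoʳ-≤ (- x) p)

  x-y≈0⇒x≈y : ∀ {x y} → x - y ≈ 0# → x ≈ y
  x-y≈0⇒x≈y {x} {y} p = trans (solve 2 (λ x y → x := y :+ (x :- y)) refl x y)
    (trans (+-congˡ p) (+-identityʳ y))

  x-y≤0⇒x≤y : ∀ {x y} → x - y ≤ 0# → x ≤ y
  x-y≤0⇒x≤y {x} {y} p = from-diff (neg-nonNeg p)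
    (solve 2 (λ x y → y :- x := :- (x :- y)) refl x y)

  +-mono-<-≤ : ∀ {x y u v} → x < y → u ≤ v → x + u < y + v
  +-mono-<-≤ {x} {y} {u} {v} p q r = p (from-diff (+-nonNeg (x≤y⇒0≤y-x r) (x≤y⇒0≤y-x q))
    (solve 4 (λ x y u v → x :- y := ((x :+ u) :- (y :+ v)) :+ (v :- u)) refl x y u v))

  *-monoˡ-≤ : ∀ {x y z} → 0# ≤ x → y ≤ z → x * y ≤ x * z
  *-monoˡ-≤ {x} {y} {z} p q = from-diff (*-nonNeg p (x≤y⇒0≤y-x q))
    (solve 3 (λ x y z → x :* z :- x :* y := x :* (z :- y)) refl x y z)

  x≤y⇒x-y≤0 : ∀ {x y} → x ≤ y → x - y ≤ 0#
  x≤y⇒x-y≤0 {x} {y} x≤y = ≤-resp (+-comm (- y) x) (-‿inverseˡ y) (+-monoʳ-≤ (- y) x≤y)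

  <⇒0<y-x : ∀ {x y} → x < y → 0# < y - x
  <⇒0<y-x x<y y-x≤0 = x<y (x-y≤0⇒x≤y y-x≤0)

  *-monoˡ-≤-nonPos : ∀ {x y z} → x ≤ 0# → y ≤ z → x * z ≤ x * y
  *-monoˡ-≤-nonPos {x} {y} {z} x≤0 y≤z = from-diff (*-nonNeg (neg-nonNeg x≤0) (x≤y⇒0≤y-x y≤z))
    (solve 3 (λ x y z → x :* y :- x :* z := (:- x) :* (z :- y)) refl x y z)

  *-nonZero : ∀ {x y} → x ≉ 0# → y ≉ 0# → x * y ≉ 0#
  *-nonZero {x} {y} p q xy≈0 = (do
    (z , xz≈1) ← inverse p
    return (q (begin
      y            ≈⟨ *-identityˡ y ⟨
      1# * y       ≈⟨ *-congʳ xz≈1 ⟨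
      (x * z) * y  ≈⟨ solve 3 (λ x y z → (x :* z) :* y := z :* (x :* y)) refl x y z ⟩
      z * (x * y)  ≈⟨ *-congˡ xy≈0 ⟩
      z * 0#       ≈⟨ zeroʳ z ⟩
      0#           ∎))) λ z → z
    where open import Relation.Binary.Reasoning.Setoid setoid

  *-pos : ∀ {x y} → 0# < x → 0# < y → 0# < x * y
  *-pos p q = ≤∧≉⇒< (*-nonNeg (<⇒≤ p) (<⇒≤ q))
    λ 0≈xy → *-nonZero (λ x≈0 → <⇒≉ p (sym x≈0)) (λ y≈0 → <⇒≉ q (sym y≈0)) (sym 0≈xy)

  neg-pos : ∀ {x} → x < 0# → 0# < - x
  neg-pos {x} p q = p (≤-resp (-‿inverseʳ x) (+-identityʳ x) (+-monoʳ-≤ x q))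

  *-monoˡ-< : ∀ {x y z} → 0# < x → y < z → x * y < x * z
  *-monoˡ-< {x} {y} {z} 0<x y<z xz≤xy = *-pos 0<x (<⇒0<y-x y<z) (≤-resp
    (solve 3 (λ x y z → x :* z :- x :* y := x :* (z :- y)) refl x y z) refl (x≤y⇒x-y≤0 xz≤xy))

  *-monoˡ-<-neg : ∀ {x y z} → x < 0# → y < z → x * z < x * y
  *-monoˡ-<-neg {x} {y} {z} x<0 y<z xy≤xz = *-pos (neg-pos x<0) (<⇒0<y-x y<z) (≤-resp
    (solve 3 (λ x y z → x :* y :- x :* z := (:- x) :* (z :- y)) refl x y z) refl (x≤y⇒x-y≤0 xy≤xz))

  *-cancel-nonNeg : ∀ {x y} → 0# < x → 0# ≤ x * y → 0# ≤ y
  *-cancel-nonNeg {x} {y} p q = ≤-stable λ 0≰y →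
    *-pos p (neg-pos 0≰y) (from-diff q
      (trans (+-identityˡ (- (x * - y))) (solve 2 (λ x y → :- (x :* (:- y)) := x :* y) refl x y)))

  *-square : ∀ x → 0# ≤ x * x
  *-square x = ≤-stable (do
    inj₁ 0≤x ← ≤-total 0# x
      where inj₂ x≤0 → return (≤-resp refl
              (solve 1 (λ x → (:- x) :* (:- x) := x :* x) refl x)
              (*-nonNeg (neg-nonNeg x≤0) (neg-nonNeg x≤0)))
    return (*-nonNeg 0≤x 0≤x))

  *-square-pos : ∀ {x} → x ≉ 0# → 0# < x * x
  *-square-pos {x} p = ≤∧≉⇒< (*-square x) λ eq → *-nonZero p p (sym eq)

  0<1 : 0# < 1#
  0<1 = ≤∧≉⇒< (≤-resp refl (*-identityˡ 1#) (*-square 1#)) λ eq → 1≉0 (sym eq)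

  inverse-pos : ∀ {x} → 0# < x → ¬ ¬ (∃[ y ] (0# < y × x * y ≈ 1#))
  inverse-pos {x} 0<x = do
    (y , xy≈1) ← inverse (λ x≈0 → <⇒≉ 0<x (sym x≈0))
    let 0≤y = *-cancel-nonNeg 0<x (≤-resp refl (sym xy≈1) (<⇒≤ 0<1))
    return (y , ≤∧≉⇒< 0≤y (λ 0≈y →
      1≉0 (trans (sym xy≈1) (trans (*-congˡ (sym 0≈y)) (zeroʳ x)))) , xy≈1)

  data Sign (x : F) : Set where
    neg  : x < 0# → Sign x
    null : x ≈ 0# → Sign x
    pos  : 0# < x → Sign x

  sign : ∀ x → ¬ ¬ Sign x
  sign x = do
    no x≉0 ← em {A = x ≈ 0#}
      where yes x≈0 → return (null x≈0)
    inj₁ 0≤x ← ≤-total 0# x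
      where inj₂ x≤0 → return (neg (≤∧≉⇒< x≤0 x≉0))
    return (pos (≤∧≉⇒< 0≤x λ eq → x≉0 (sym eq)))

by-cases : ∀ {p n} {P : Fin n → Set p} i → P i → (∀ j → j ≢ i → P j) → ∀ j → P j
by-cases i Pᵢ else j with j Fin.≟ i
... | yes ≡.refl = Pᵢ
... | no j≢i     = else j j≢i

-- Linear algebra: dot products, dependencies, affine independence

module Linear (K : OrderedField) where
  open Order K
  open import Algebra.Properties.Semiring.Sum semiring public
    using (sum; sum-cong-≋; sum-remove; ∑-distrib-+; ∑-comm; *-distribˡ-sum; sum-replicate-zero)
  open import Relation.Binary.Reasoning.Setoid setoid

  infix 8 _∙_

  Vec : ℕ → Set
  Vec = V.Vector F

  _∙_ : ∀ {d} → Vec d → Vec d → F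
  a ∙ x = sum λ i → a i * x i

  lincomb : ∀ {m d} → Vec m → (Fin m → Vec d) → Vec d
  lincomb c v i = sum λ j → c j * v j i

  Dependency : ∀ {m d} → (Fin m → Vec d) → Vec m → Set
  Dependency v c = ∀ i → lincomb c v i ≈ 0#

  AffinelyIndependent : ∀ {m d} → (Fin m → Vec d) → Set
  AffinelyIndependent p = ∀ c → sum c ≈ 0# → Dependency p c → ∀ j → c j ≈ 0#

  sum-cong : ∀ {n} {f g : Vec n} → (∀ i → f i ≈ g i) → sum f ≈ sum g
  sum-cong = sum-cong-≋

  sum-zero : ∀ {n} {f : Vec n} → (∀ i → f i ≈ 0#) → sum f ≈ 0#
  sum-zero {n} h = trans (sum-cong h) (sum-replicate-zero n)

  sum-mono-≤ : ∀ {n} {f g : Vec n} → (∀ i → f i ≤ g i) → sum f ≤ sum g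
  sum-mono-≤ {zero}  h = ≤-refl
  sum-mono-≤ {suc n} h = +-mono-≤ (h zero) (sum-mono-≤ (λ i → h (suc i)))

  sum-single : ∀ {n} (f : Vec n) i → (∀ j → j ≢ i → f j ≈ 0#) → sum f ≈ f i
  sum-single {suc n} f i h = trans (sum-remove {i = i} f)
    (trans (+-congˡ (sum-zero λ j → h (punchIn i j) (Fin.punchInᵢ≢i i j))) (+-identityʳ (f i)))

  sum-drop : ∀ {n} (f : Vec (suc n)) i → f i ≈ 0# → sum f ≈ sum (f ∘ punchIn i)
  sum-drop f i fᵢ≈0 = trans (sum-remove {i = i} f) (trans (+-congʳ fᵢ≈0) (+-identityˡ _))

  ∙-cong : ∀ {d} {a a′ x x′ : Vec d} → (∀ i → a i ≈ a′ i) → (∀ i → x i ≈ x′ i) →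
    a ∙ x ≈ a′ ∙ x′
  ∙-cong p q = sum-cong λ i → *-cong (p i) (q i)

  ∙-comm : ∀ {d} (a x : Vec d) → a ∙ x ≈ x ∙ a
  ∙-comm {d} a x = sum-cong {d} λ i → *-comm (a i) (x i)

  sum-linear : ∀ {n} s t (f g : Vec n) → sum (λ i → s * f i + t * g i) ≈ s * sum f + t * sum g
  sum-linear s t f g = trans (∑-distrib-+ (λ i → s * f i) (λ i → t * g i))
    (+-cong (sym (*-distribˡ-sum s f)) (sym (*-distribˡ-sum t g)))

  ∙-linearˡ : ∀ {d} s t (a b x : Vec d) → (λ i → s * a i + t * b i) ∙ x ≈ s * a ∙ x + t * b ∙ x
  ∙-linearˡ s t a b x = trans
    (sum-cong λ i → solve 5 (λ s t a b x → (s :* a :+ t :* b) :* x := s :* (a :* x) :+ t :* (b :* x))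
      refl s t (a i) (b i) (x i))
    (sum-linear s t (λ i → a i * x i) (λ i → b i * x i))

  ∙-linearʳ : ∀ {d} s t (a x y : Vec d) → a ∙ (λ i → s * x i + t * y i) ≈ s * a ∙ x + t * a ∙ y
  ∙-linearʳ s t a x y = trans
    (sum-cong λ i → solve 5 (λ s t a x y → a :* (s :* x :+ t :* y) := s :* (a :* x) :+ t :* (a :* y))
      refl s t (a i) (x i) (y i))
    (sum-linear s t (λ i → a i * x i) (λ i → a i * y i))

  ∙-scaleˡ : ∀ {d} s (a x : Vec d) → (λ i → s * a i) ∙ x ≈ s * a ∙ x
  ∙-scaleˡ s a x = trans (sum-cong λ i → *-assoc s (a i) (x i))
    (sym (*-distribˡ-sum s (λ i → a i * x i)))

  ∙-lincombˡ : ∀ {m d} (c : Vec m) (v : Fin m → Vec d) x →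
    lincomb c v ∙ x ≈ sum λ j → c j * v j ∙ x
  ∙-lincombˡ {m} {d} c v x = begin
    sum (λ i → sum (λ j → c j * v j i) * x i)
      ≈⟨ sum-cong (λ i → trans (*-comm _ _) (*-distribˡ-sum (x i) (λ j → c j * v j i))) ⟩
    sum (λ i → sum (λ j → x i * (c j * v j i)))
      ≈⟨ ∑-comm (λ i j → x i * (c j * v j i)) ⟩
    sum (λ j → sum (λ i → x i * (c j * v j i)))
      ≈⟨ sum-cong (λ j → trans
           (sum-cong λ i → solve 3 (λ x c v → x :* (c :* v) := c :* (v :* x)) refl (x i) (c j) (v j i))
           (sym (*-distribˡ-sum (c j) (λ i → v j i * x i)))) ⟩
    sum (λ j → c j * v j ∙ x) ∎

  ∙-lincombʳ : ∀ {m d} a (c : Vec m) (v : Fin m → Vec d) →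
    a ∙ lincomb c v ≈ sum λ j → c j * a ∙ v j
  ∙-lincombʳ {m} a c v = begin
    a ∙ lincomb c v               ≈⟨ ∙-comm a (lincomb c v) ⟩
    lincomb c v ∙ a               ≈⟨ ∙-lincombˡ c v a ⟩
    sum (λ j → c j * v j ∙ a)     ≈⟨ sum-cong {m} (λ j → *-congˡ (∙-comm (v j) a)) ⟩
    sum (λ j → c j * a ∙ v j)     ∎

  lincomb-linear : ∀ {m d} s t (c e : Vec m) (v : Fin m → Vec d) i →
    lincomb (λ j → s * c j + t * e j) v i ≈ s * lincomb c v i + t * lincomb e v i
  lincomb-linear s t c e v i = ∙-linearˡ s t c e (λ j → v j i)

  Dependency-linear : ∀ {m d} s t (c e : Vec m) (v : Fin m → Vec d) →
    Dependency v c → Dependency v e → Dependency v (λ j → s * c j + t * e j)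
  Dependency-linear s t c e v p q i = begin
    lincomb (λ j → s * c j + t * e j) v i          ≈⟨ lincomb-linear s t c e v i ⟩
    s * lincomb c v i + t * lincomb e v i          ≈⟨ +-cong (*-congˡ (p i)) (*-congˡ (q i)) ⟩
    s * 0# + t * 0#                                ≈⟨ +-cong (zeroʳ s) (zeroʳ t) ⟩
    0# + 0#                                        ≈⟨ +-identityˡ 0# ⟩
    0#                                             ∎

  Dependency-neg : ∀ {m d} (c : Vec m) (v : Fin m → Vec d) →
    Dependency v c → Dependency v (λ j → - 1# * c j)
  Dependency-neg c v p i = trans (∙-scaleˡ (- 1#) c (λ j → v j i)) (trans (*-congˡ (p i)) (zeroʳ (- 1#)))

  nonNeg-∙-neg : ∀ {d} {a x : Vec d} → 0# ≤ a ∙ x → (λ i → - 1# * a i) ∙ x ≤ 0#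
  nonNeg-∙-neg {a = a} {x} p = ≤-resp (sym (trans (∙-scaleˡ (- 1#) a x) (-1*x≈-x (a ∙ x)))) refl (nonNeg-neg p)

  nonzero-coordinate : ∀ {d} (a : Vec d) → ¬ (∀ i → a i ≈ 0#) → ¬ ¬ (∃[ i ] a i ≉ 0#)
  nonzero-coordinate a = ¬∀⇒¬¬∃¬ λ i → ≈-stable

  private
    nonzero-coordinate? : ∀ {d} (a : Vec d) → ¬ ¬ ((∀ i → a i ≈ 0#) ⊎ ∃[ i ] a i ≉ 0#)
    nonzero-coordinate? a = do
      no a≉0 ← em {A = ∀ i → a i ≈ 0#}
        where yes a≈0 → return (inj₁ a≈0)
      i ← nonzero-coordinate a a≉0
      return (inj₂ i)

  -- Gaussian elimination: a nonzero coordinate of the first vector clears that coordinate in the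
  -- others, induction applies to the remaining coordinates, and the coefficient of the first vector
  -- is chosen to cancel what is left. If the first vector is zero, it is a dependency by itself.
  dependent : ∀ {d m} → d ℕ.< m → (v : Fin m → Vec d) →
    ¬ ¬ (∃[ c ] (Dependency v c × ∃[ j ] c j ≉ 0#))
  dependent {zero}  {suc m} d<m v = return ((λ _ → 1#) , (λ ()) , zero , 1≉0)
  dependent {suc d} {suc m} (s≤s d<m) v = do
    inj₂ (i , pivot≉0) ← nonzero-coordinate? (v zero)
      where inj₁ v₀≈0 → return ((1# V.∷ λ _ → 0#) ,
              (λ i → trans (+-cong (trans (*-identityˡ _) (v₀≈0 i)) (sum-zero λ j → zeroˡ (v (suc j) i)))
                           (+-identityˡ 0#)) ,
              zero , 1≉0)
    let pivot = v zero i
        reduced : Fin m → Vec (suc d)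
        reduced j r = pivot * v (suc j) r + - v (suc j) i * v zero r
    (e , dep , l , eₗ≉0) ← dependent {d} {m} d<m (λ j r → reduced j (punchIn i r))
    let reduced-dep : Dependency reduced e
        reduced-dep = by-cases i
          (sum-zero λ j → trans
            (*-congˡ (trans (solve 2 (λ a b → a :* b :+ (:- b) :* a := a :- a) refl pivot (v (suc j) i))
              (-‿inverseʳ pivot)))
            (zeroʳ (e j)))
          λ r r≢i → ≡.subst (λ r → lincomb e reduced r ≈ 0#)
            (Fin.punchIn-punchOut (r≢i ∘ ≡.sym)) (dep (punchOut (r≢i ∘ ≡.sym)))
        c : Vec (suc m)
        c = - (sum λ j → e j * v (suc j) i) V.∷ λ j → pivot * e j
    return (c , (λ r → begin
        - (sum λ j → e j * v (suc j) i) * v zero r + (sum λ j → pivot * e j * v (suc j) r)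
          ≈⟨ +-comm _ _ ⟩
        (sum λ j → pivot * e j * v (suc j) r) + - (sum λ j → e j * v (suc j) i) * v zero r
          ≈⟨ +-cong (trans (sum-cong {m} λ j → *-assoc pivot (e j) (v (suc j) r)) (sym (*-distribˡ-sum pivot (λ j → e j * v (suc j) r))))
               (solve 2 (λ a b → (:- a) :* b := (:- b) :* a) refl _ (v zero r)) ⟩
        pivot * (sum λ j → e j * v (suc j) r) + - v zero r * (sum λ j → e j * v (suc j) i)
          ≈⟨ sum-linear pivot (- v zero r) (λ j → e j * v (suc j) r) (λ j → e j * v (suc j) i) ⟨
        (sum λ j → pivot * (e j * v (suc j) r) + - v zero r * (e j * v (suc j) i))
          ≈⟨ sum-cong (λ j → solve 5 (λ p e x z y → p :* (e :* x) :+ (:- z) :* (e :* y) := e :* (p :* x :+ (:- y) :* z))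
               refl pivot (e j) (v (suc j) r) (v zero r) (v (suc j) i)) ⟩
        lincomb e reduced r
          ≈⟨ reduced-dep r ⟩
        0# ∎) ,
      suc l , *-nonZero pivot≉0 eₗ≉0)

  module _ {d : ℕ} {a : Vec d} {i : Fin d} (aᵢ≉0 : a i ≉ 0#) where

    -- Replacing the i-th coordinates of the points by 1 turns an affine
    -- dependency into a linear one; the i-th equation is recovered from a ∙ p j ≈ b.
    hyperplane-dependent : ∀ {b} (p : Fin (suc d) → Vec d) → (∀ j → a ∙ p j ≈ b) →
      ¬ AffinelyIndependent p
    hyperplane-dependent {b} p on independent = (do
      (c , dep , j , cⱼ≉0) ← dependent (ℕ.s≤s ℕ.≤-refl) q
      let sum-c : sum c ≈ 0#
          sum-c = trans (sum-cong {f = c} λ j → trans (sym (*-identityʳ (c j))) (*-congˡ {c j} (sym (q-i j)))) (dep i)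
          off-i : ∀ r → r ≢ i → lincomb c p r ≈ 0#
          off-i r r≢i = trans (sum-cong {suc d} λ j → *-congˡ {c j} (sym (q-off j r r≢i))) (dep r)
          aᵢ*≈0 : a i * lincomb c p i ≈ 0#
          aᵢ*≈0 = begin
            a i * lincomb c p i
              ≈⟨ sum-single (λ r → a r * lincomb c p r) i (λ r r≢i → trans (*-congˡ (off-i r r≢i)) (zeroʳ (a r))) ⟨
            a ∙ lincomb c p            ≈⟨ ∙-lincombʳ a c p ⟩
            sum (λ j → c j * a ∙ p j)  ≈⟨ sum-cong (λ j → trans (*-congˡ (on j)) (*-comm (c j) b)) ⟩
            sum (λ j → b * c j)        ≈⟨ *-distribˡ-sum b c ⟨
            b * sum c                  ≈⟨ *-congˡ sum-c ⟩
            b * 0#                     ≈⟨ zeroʳ b ⟩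
            0#                         ∎
          at-i : lincomb c p i ≈ 0#
          at-i = ≈-stable λ ≉0 → *-nonZero aᵢ≉0 ≉0 aᵢ*≈0
      return (cⱼ≉0 (independent c sum-c (by-cases i at-i off-i) j))) λ z → z
      where
      q : Fin (suc d) → Vec d
      q j r with r Fin.≟ i
      ... | yes _ = 1#
      ... | no _  = p j r
      q-i : ∀ j → q j i ≈ 1#
      q-i j with i Fin.≟ i
      ... | yes _  = refl
      ... | no i≢i = contradiction ≡.refl i≢i
      q-off : ∀ j r → r ≢ i → q j r ≈ p j r
      q-off j r r≢i with r Fin.≟ i
      ... | yes r≡i = contradiction r≡i r≢i
      ... | no _    = refl

-- Farkas' lemma

module Farkas (K : OrderedField) where
  open Order K
  open Linear K
  open import Relation.Binary.Reasoning.Setoid setoid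

  Constraint : ℕ → Set
  Constraint d = Vec d × F

  Sat : ∀ {d} → Vec d → Constraint d → Set
  Sat x (a , b) = a ∙ x ≤ b

  -- An abstract predicate replaces explicit multipliers: elimination only needs closure under
  -- nonnegative combinations, and the caller decides what evidence a derived inequality carries.
  record Cone {d} (C : Vec d → F → Set) : Set where
    field
      add   : ∀ {a b a′ b′} → C a b → C a′ b′ → C (λ i → a i + a′ i) (b + b′)
      scale : ∀ {s a b} → 0# ≤ s → C a b → C (λ i → s * a i) (s * b)
      resp  : ∀ {a b a′ b′} → (∀ i → a i ≈ a′ i) → b ≈ b′ → C a b → C a′ b′

  -- The witness is the least of 0 and the upper values, raised to the greatest lower value if that
  -- is larger.
  between : ∀ {A B : Set} (lo : A → F) (hi : B → F) ws us →
    (∀ {w u} → w List.∈ ws → u List.∈ us → lo w ≤ hi u) →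
    ¬ ¬ (∃[ t ] (All (λ w → lo w ≤ t) ws × All (λ u → t ≤ hi u) us))
  between lo hi [] [] h = return (0# , [] , [])
  between lo hi [] (u ∷ us) h = do
    (t , [] , t≤us) ← between lo hi [] us λ ()
    inj₁ t≤u ← ≤-total t (hi u)
      where inj₂ u≤t → return (hi u , [] , ≤-refl ∷ All.map (≤-trans u≤t) t≤us)
    return (t , [] , t≤u ∷ t≤us)
  between lo hi (w ∷ ws) us h = do
    (t , ws≤t , t≤us) ← between lo hi ws us (h ∘ there)
    inj₁ w≤t ← ≤-total (lo w) t
      where inj₂ t≤w → return (lo w , ≤-refl ∷ All.map (λ p → ≤-trans p t≤w) ws≤t , All.tabulate (h (here ≡.refl)))
    return (t , w≤t ∷ ws≤t , t≤us)

  private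
    ∷-cong : ∀ {d} {a a′ : Vec (suc d)} → a zero ≈ a′ zero → (∀ i → a (suc i) ≈ a′ (suc i)) → ∀ i → a i ≈ a′ i
    ∷-cong p q zero    = p
    ∷-cong p q (suc i) = q i

    addᶜ : ∀ {d} → Constraint d → Constraint d → Constraint d
    addᶜ (a , b) (a′ , b′) = (λ i → a i + a′ i) , b + b′

    ∙-add : ∀ {d} (a b x : Vec d) → (λ i → a i + b i) ∙ x ≈ a ∙ x + b ∙ x
    ∙-add {d} a b x = trans (sum-cong {d} λ i → distribʳ (x i) (a i) (b i)) (∑-distrib-+ (λ i → a i * x i) (λ i → b i * x i))

  module _ {d : ℕ} {C : Vec (suc d) → F → Set} (cone : Cone C) where
    open Cone cone

    eliminated : Cone (λ a b → C (0# V.∷ a) b)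
    eliminated = record
      { add   = λ p q → resp (∷-cong (+-identityˡ 0#) (λ _ → refl)) refl (add p q)
      ; scale = λ {s} 0≤s p → resp (∷-cong (zeroʳ s) (λ _ → refl)) refl (scale 0≤s p)
      ; resp  = λ p q → resp (∷-cong refl p) q
      }

    -- Dividing by the absolute value of the first coefficient leaves only 0, 1 or -1 there, so the
    -- sum of an upper and a lower constraint no longer involves the first variable.
    record Normalised (cs : List (Constraint (suc d))) : Set where
      field
        flat upper lower : List (Constraint d)
        flat∈C  : All (λ (a , b) → C (0# V.∷ a) b) flat
        upper∈C : All (λ (a , b) → C (1# V.∷ a) b) upper
        lower∈C : All (λ (a , b) → C (- 1# V.∷ a) b) lower
        sat     : ∀ t x → All (Sat x) flat → All (λ (a , b) → t ≤ b - a ∙ x) upper →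
                  All (λ (a , b) → a ∙ x - b ≤ t) lower → All (Sat (t V.∷ x)) cs

    normalise : ∀ cs → All (uncurry C) cs → ¬ ¬ Normalised cs
    normalise [] [] = return record
      { flat = [] ; upper = [] ; lower = [] ; flat∈C = [] ; upper∈C = [] ; lower∈C = []
      ; sat = λ _ _ _ _ _ → [] }
    normalise ((a , b) ∷ cs) (c ∷ all) = do
      N ← normalise cs all
      s ← sign (a zero)
      insert N s
      where
      insert : Normalised cs → Sign (a zero) → ¬ ¬ Normalised ((a , b) ∷ cs)
      insert N (null a₀≈0) = return record
        { Normalised N
        ; flat = (a ∘ suc , b) ∷ flat
        ; flat∈C = resp (∷-cong a₀≈0 (λ _ → refl)) refl c ∷ flat∈C
        ; sat = λ { t x (f ∷ fs) us ls →
            ≤-resp (sym (trans (+-congʳ (trans (*-congʳ a₀≈0) (zeroˡ t))) (+-identityˡ _))) refl f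
              ∷ sat t x fs us ls }
        } where open Normalised N
      insert N (pos 0<a₀) = do
        (y , 0<y , a₀y≈1) ← inverse-pos 0<a₀
        return record
          { Normalised N
          ; upper = ((λ i → y * a (suc i)) , y * b) ∷ upper
          ; upper∈C = resp (∷-cong (trans (*-comm y (a zero)) a₀y≈1) (λ _ → refl)) refl (scale (<⇒≤ 0<y) c) ∷ upper∈C
          ; sat = λ { t x fs (u ∷ us) ls →
              from-diff (*-nonNeg (<⇒≤ 0<a₀) (x≤y⇒0≤y-x (≤-trans u
                (≤-reflexive (+-congˡ (-‿cong (∙-scaleˡ y (a ∘ suc) x)))))))
                (begin
                  b - (a zero * t + (a ∘ suc) ∙ x)
                    ≈⟨ solve 3 (λ b c d → b :- (d :+ c) := (b :- c) :- d) refl b ((a ∘ suc) ∙ x) (a zero * t) ⟩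
                  (b - (a ∘ suc) ∙ x) - a zero * t
                    ≈⟨ +-congʳ (trans (sym (*-identityˡ _)) (*-congʳ (sym a₀y≈1))) ⟩
                  (a zero * y) * (b - (a ∘ suc) ∙ x) - a zero * t
                    ≈⟨ solve 5 (λ a y b c t → (a :* y) :* (b :- c) :- a :* t := a :* ((y :* b :- y :* c) :- t))
                         refl (a zero) y b ((a ∘ suc) ∙ x) t ⟩
                  a zero * (y * b - y * (a ∘ suc) ∙ x - t) ∎)
                ∷ sat t x fs us ls }
          }
        where open Normalised N
      insert N (neg a₀<0) = do
        (y , 0<y , -a₀y≈1) ← inverse-pos (neg-pos a₀<0)
        return record
          { Normalised N
          ; lower = ((λ i → y * a (suc i)) , y * b) ∷ lower
          ; lower∈C = resp (∷-cong (trans (solve 2 (λ y a → y :* a := :- ((:- a) :* y)) refl y (a zero)) (-‿cong -a₀y≈1))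
                        (λ _ → refl)) refl (scale (<⇒≤ 0<y) c) ∷ lower∈C
          ; sat = λ { t x fs us (l ∷ ls) →
              from-diff (*-nonNeg (<⇒≤ (neg-pos a₀<0)) (x≤y⇒0≤y-x (≤-trans
                (≤-reflexive (+-congʳ (sym (∙-scaleˡ y (a ∘ suc) x)))) l)))
                (begin
                  b - (a zero * t + (a ∘ suc) ∙ x)
                    ≈⟨ solve 4 (λ b c a t → b :- (a :* t :+ c) := (:- a) :* t :- (c :- b)) refl b ((a ∘ suc) ∙ x) (a zero) t ⟩
                  - a zero * t - ((a ∘ suc) ∙ x - b)
                    ≈⟨ +-congˡ (-‿cong (trans (sym (*-identityˡ _)) (*-congʳ (sym -a₀y≈1)))) ⟩
                  - a zero * t - (- a zero * y) * ((a ∘ suc) ∙ x - b)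
                    ≈⟨ solve 5 (λ a y b c t → (:- a) :* t :- ((:- a) :* y) :* (c :- b) := (:- a) :* (t :- (y :* c :- y :* b)))
                         refl (a zero) y b ((a ∘ suc) ∙ x) t ⟩
                  - a zero * (t - (y * (a ∘ suc) ∙ x - y * b)) ∎)
                ∷ sat t x fs us ls }
          }
        where open Normalised N

    addᶜ∈C : ∀ {upper lower} → All (λ (a , b) → C (1# V.∷ a) b) upper → All (λ (a , b) → C (- 1# V.∷ a) b) lower →
      All (λ (a , b) → C (0# V.∷ a) b) (cartesianProductWith addᶜ upper lower)
    addᶜ∈C {upper} {lower} us ls = All.tabulate λ m →
      let _ , _ , u∈ , l∈ , eq = ∈-cartesianProductWith⁻ addᶜ upper lower m
      in ≡.subst (λ (a , b) → C (0# V.∷ a) b) (≡.sym eq)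
           (resp (∷-cong (-‿inverseʳ 1#) (λ _ → refl)) refl (add (All.lookup us u∈) (All.lookup ls l∈)))

  -- Fourier–Motzkin elimination of the first variable.
  farkas : ∀ {d} {C : Vec d → F → Set} → Cone C → ∀ cs → All (uncurry C) cs →
    ¬ ¬ ((∃[ x ] All (Sat x) cs) ⊎ (∃[ b ] (b < 0# × C (λ _ → 0#) b)))
  farkas {zero} cone [] [] = return (inj₁ ((λ ()) , []))
  farkas {zero} cone ((a , b) ∷ cs) (c ∷ all) = do
    inj₁ (x , sat) ← farkas {zero} cone cs all
      where inj₂ separated → return (inj₂ separated)
    yes 0≤b ← em {A = 0# ≤ b}
      where no b<0 → return (inj₂ (b , b<0 , Cone.resp cone (λ ()) refl c))
    return (inj₁ (x , 0≤b ∷ sat))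
  farkas {suc d} {C} cone cs all = do
    N ← normalise cone cs all
    let open Normalised N
    inj₁ (x , x-sat) ← farkas (eliminated cone) (flat ++ cartesianProductWith addᶜ upper lower) 
      (All.++⁺ flat∈C (addᶜ∈C cone upper∈C lower∈C))
      where inj₂ (b , b<0 , c) → return (inj₂ (b , b<0 , Cone.resp cone (∷-cong refl (λ _ → refl)) refl c))
    let sat-addᶜd = All.++⁻ʳ flat x-sat
    (t , lower≤t , t≤upper) ← between (λ (a , b) → a ∙ x - b) (λ (a , b) → b - a ∙ x) lower upper
      λ {w} {u} w∈ u∈ → from-diff
        (x≤y⇒0≤y-x (All.lookup sat-addᶜd (∈-cartesianProductWith⁺ addᶜ u∈ w∈)))
        (trans (solve 4 (λ b c b′ c′ → (b :- c) :- (c′ :- b′) := (b :+ b′) :- (c :+ c′)) refl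
            (proj₂ u) (proj₁ u ∙ x) (proj₂ w) (proj₁ w ∙ x))
          (+-congˡ (-‿cong (sym (∙-add (proj₁ u) (proj₁ w) x)))))
    return (inj₁ (t V.∷ x , sat t x (All.++⁻ˡ flat x-sat) t≤upper lower≤t))

-- Circuits and sign-preserving reduction of the support

module Circuits (K : OrderedField) where
  open Order K
  open Linear K
  open import Relation.Binary.Reasoning.Setoid setoid

  -- Classically, the family is a circuit of the linear matroid or independent; in both cases any
  -- two dependencies are proportional.
  Circuit : ∀ {m d} → (Fin m → Vec d) → Set
  Circuit v = ∀ c → Dependency v c → ∀ j → c j ≈ 0# → ∀ l → c l ≈ 0#

  -- Multiply the two hypotheses and cancel the positive factor `x * x`.
  sign-transfer : ∀ {x y r} → x ≉ 0# → 0# ≤ x * y → 0# ≤ x * r → 0# ≤ y * r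
  sign-transfer {x} {y} {r} x≉0 p q = *-cancel-nonNeg (*-square-pos x≉0)
    (≤-resp refl (solve 3 (λ x y r → (x :* y) :* (x :* r) := (x :* x) :* (y :* r)) refl x y r)
      (*-nonNeg p q))

  module _ {m d : ℕ} (v : Fin m → Vec d) (ρ : Vec m) where

    -- `refines` says that `c′ j` is a nonnegative multiple of `c j`, phrased so that any bound
    -- valid for the sign of `c j` carries over at once.
    record Shrunk (c : Vec m) : Set where
      field
        c′       : Vec m
        dep      : Dependency v c′
        negative : c′ ∙ ρ < 0#
        vanishes : ∃[ j ] c′ j ≈ 0#
        refines  : ∀ j r → 0# ≤ c j * r → 0# ≤ c′ j * r

    module _ {c : Vec m} (dep : Dependency v c) (cρ<0 : c ∙ ρ < 0#) where

      -- Move from c in the direction e until the first coordinate vanishes.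
      shift : (∀ j → c j ≉ 0#) → ∀ e → Dependency v e → e ∙ ρ ≤ 0# → ∃[ j ] (c j * e j < 0#) → ¬ ¬ Shrunk c
      shift c≉0 e dep-e eρ≤0 opposite = do
        inv ← ¬¬∀ inverses
        let ratio : Vec m
            ratio j = - c j * proj₁ (inv j)
            ratio-e : ∀ j → c j * e j < 0# → ratio j * e j ≈ - c j
            ratio-e = λ j c*e<0 → trans
              (solve 3 (λ c y e → (:- c) :* y :* e := (:- c) :* (e :* y)) refl (c j) (proj₁ (inv j)) (e j))
              (trans (*-congˡ (proj₂ (inv j) (λ e≈0 → <⇒≉ c*e<0 (trans (*-congˡ e≈0) (zeroʳ (c j))))))
                (*-identityʳ (- c j)))
        -- Coordinate `l` of `c + t e` vanishes at `t = ratio l`. The least ratio over the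
        -- coordinates where `e` opposes `c` is the first zero that is met, and no sign has changed
        -- before it.
        (j , cⱼeⱼ<0 , min) ← minimum (λ i l → ratio i ≤ ratio l)
          (λ _ → ≤-refl) ≤-trans (λ i l → ≤-total (ratio i) (ratio l)) (λ j → c j * e j < 0#) opposite
        let t = ratio j
            eⱼ≉0 : e j ≉ 0#
            eⱼ≉0 = λ e≈0 → <⇒≉ cⱼeⱼ<0 (trans (*-congˡ e≈0) (zeroʳ (c j)))
            0≤t : 0# ≤ t
            0≤t = *-cancel-nonNeg (*-square-pos eⱼ≉0) (≤-resp refl (sym (begin
              e j * e j * t      ≈⟨ solve 2 (λ e t → e :* e :* t := e :* (t :* e)) refl (e j) t ⟩
              e j * (t * e j)    ≈⟨ *-congˡ (ratio-e j cⱼeⱼ<0) ⟩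
              e j * (- c j)      ≈⟨ solve 2 (λ e c → e :* (:- c) := :- (c :* e)) refl (e j) (c j) ⟩
              - (c j * e j)      ∎)) (<⇒≤ (neg-pos cⱼeⱼ<0)))
            c′ : Vec m
            c′ l = 1# * c l + t * e l
            one : ∀ x → 1# * x ≈ x
            one = *-identityˡ
            opposite-sign : ∀ l → c l * e l < 0# → 0# ≤ c l * c′ l
            opposite-sign = λ l cₗeₗ<0 → ≤-resp refl (begin
              - (c l * e l) * (ratio l - t)
                ≈⟨ solve 4 (λ c e f t → (:- (c :* e)) :* (f :- t) := c :* ((:- (f :* e)) :+ t :* e)) refl (c l) (e l) (ratio l) t ⟩
              c l * (- (ratio l * e l) + t * e l)
                ≈⟨ *-congˡ (+-congʳ (trans (-‿cong (ratio-e l cₗeₗ<0))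
                     (trans (-‿involutive (c l)) (sym (one (c l)))))) ⟩
              c l * c′ l ∎)
              (*-nonNeg (<⇒≤ (neg-pos cₗeₗ<0)) (x≤y⇒0≤y-x (min l cₗeₗ<0)))
            same-sign : ∀ l → 0# ≤ c l * e l → 0# ≤ c l * c′ l
            same-sign = λ l 0≤cₗeₗ → ≤-resp refl
              (trans (solve 3 (λ c e t → c :* c :+ t :* (c :* e) := c :* (c :+ t :* e)) refl (c l) (e l) t)
                (*-congˡ (+-congʳ (sym (one (c l))))))
              (+-nonNeg (*-square (c l)) (*-nonNeg 0≤t 0≤cₗeₗ))
            agrees : ∀ l → 0# ≤ c l * c′ l
            agrees = λ l → ≤-stable (do
              yes 0≤cₗeₗ ← em {A = 0# ≤ c l * e l}
                where no cₗeₗ<0 → return (opposite-sign l cₗeₗ<0)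
              return (same-sign l 0≤cₗeₗ))
        return record
          { c′ = c′
          ; dep = Dependency-linear 1# t c e v dep dep-e
          ; negative = <-resp
              (trans (+-congʳ (sym (one (c ∙ ρ)))) (sym (∙-linearˡ 1# t c e ρ)))
              (+-identityˡ 0#)
              (+-mono-<-≤ cρ<0 (≤-resp refl (zeroʳ t) (*-monoˡ-≤ 0≤t eρ≤0)))
          ; vanishes = j , trans (+-cong (one (c j)) (ratio-e j cⱼeⱼ<0)) (-‿inverseʳ (c j))
          ; refines = λ l r → sign-transfer (c≉0 l) (agrees l)
          }
        where
        inverses : ∀ j → ¬ ¬ (∃[ y ] (e j ≉ 0# → e j * y ≈ 1#))
        inverses j = do
          no e≉0 ← em {A = e j ≈ 0#}
            where yes e≈0 → return (0# , λ e≉0 → contradiction e≈0 e≉0)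
          (y , ey≈1) ← inverse e≉0
          return (y , λ _ → ey≈1)

      -- If no coordinate of e has a sign opposite to c, then either e itself will do,
      -- or e ∙ ρ ≈ 0# and one may move in the direction - e.
      shrink-nonPos : (∀ j → c j ≉ 0#) → ∀ e → Dependency v e → e ∙ ρ ≤ 0# →
        (∃[ j ] e j ≈ 0#) → (∃[ j ] e j ≉ 0#) → ¬ ¬ Shrunk c
      shrink-nonPos c≉0 e dep-e eρ≤0 vanishes (l , eₗ≉0) = do
        no no-opposite ← em {A = ∃[ j ] (c j * e j < 0#)}
          where yes opposite → shift c≉0 e dep-e eρ≤0 opposite
        let same-sign : ∀ j → 0# ≤ c j * e j
            same-sign = λ j → ≤-stable λ n → no-opposite (j , n)
        yes 0≤eρ ← em {A = 0# ≤ e ∙ ρ}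
          where no eρ<0 → return record
                  { c′ = e ; dep = dep-e ; negative = eρ<0 ; vanishes = vanishes
                  ; refines = λ j r → sign-transfer (c≉0 j) (same-sign j) }
        shift c≉0 (λ j → - 1# * e j)
          (Dependency-neg e v dep-e) (nonNeg-∙-neg {a = e} {ρ} 0≤eρ)
          (l , λ 0≤c*-e → *-pos-neg (same-sign l) (≤-resp refl (*-congˡ (-1*x≈-x (e l))) 0≤c*-e))
        where
        *-pos-neg : 0# ≤ c l * e l → ¬ 0# ≤ c l * - e l
        *-pos-neg p q = *-nonZero (c≉0 l) eₗ≉0 (≤-antisym
          (≤-resp (solve 2 (λ c e → :- (c :* (:- e)) := c :* e) refl (c l) (e l)) refl (nonNeg-neg q)) p)

      -- If the family is not a circuit, there is a nonzero dependency `e` with a zero coordinate.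
      -- Up to replacing `e` by its negative, `e ∙ ρ` is at most 0, so moving along `e` cannot spoil
      -- the negativity of `c ∙ ρ`.
      shrink : ¬ ¬ (Circuit v ⊎ Shrunk c)
      shrink = do
        no c≉0 ← em {A = ∃[ j ] c j ≈ 0#}
          where yes vanishes → return (inj₂ record
                  { c′ = c ; dep = dep ; negative = cρ<0 ; vanishes = vanishes ; refines = λ j r p → p })
        yes (e , dep-e , vanishes , l , eₗ≉0) ←
            em {A = ∃[ e ] (Dependency v e × (∃[ j ] e j ≈ 0#) × (∃[ l ] e l ≉ 0#))}
          where no none → return (inj₁ λ e dep-e j eⱼ≈0 l → ≈-stable λ eₗ≉0 → none (e , dep-e , (j , eⱼ≈0) , l , eₗ≉0))
        inj₁ eρ≤0 ← ≤-total (e ∙ ρ) 0#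
          where inj₂ 0≤eρ → (do
                  S ← shrink-nonPos (λ j cⱼ≈0 → c≉0 (j , cⱼ≈0)) (λ j → - 1# * e j) (Dependency-neg e v dep-e)
                        (nonNeg-∙-neg {a = e} {ρ} 0≤eρ)
                        (let j , eⱼ≈0 = vanishes in j , trans (*-congˡ eⱼ≈0) (zeroʳ (- 1#)))
                        (l , *-nonZero -1≉0 eₗ≉0)
                  return (inj₂ S))
        S ← shrink-nonPos (λ j cⱼ≈0 → c≉0 (j , cⱼ≈0)) e dep-e eρ≤0 vanishes (l , eₗ≉0)
        return (inj₂ S)
        where
        -1≉0 : - 1# ≉ 0#
        -1≉0 p = 1≉0 (trans (sym (-‿involutive 1#)) (trans (-‿cong p) -0#≈0#))

  module _ {d : ℕ} {E : Set} (w : E → Vec d) (X : E → Vec d → Set) where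

    -- A signed Farkas certificate: `valid` makes `c j * ρ j` an upper bound for
    -- `c j * w (T j) ∙ x`. A common point of all the sets would bound 0, the sum of the left-hand
    -- sides, by the negative number `c ∙ ρ`.
    record Certificate {m} (T : Fin m → E) : Set where
      field
        c ρ      : Vec m
        dep      : Dependency (w ∘ T) c
        negative : c ∙ ρ < 0#
        valid    : ∀ j x → X (T j) x → 0# ≤ c j * (ρ j - w (T j) ∙ x)

    -- Deleting an index with vanishing coefficient changes neither the dependency nor `c ∙ ρ`, so
    -- shrinking and deleting can be repeated by recursion on the number of indices.
    circuit-certificate : ∀ {m} {T : Fin m → E} → Certificate T →
      ¬ ¬ (∃[ n ] Σ (Fin n → E) λ U → Certificate U × Circuit (w ∘ U))
    circuit-certificate {m} {T} cert = do
      inj₂ S ← shrink (w ∘ T) ρ dep negative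
        where inj₁ circuit → return (m , T , cert , circuit)
      drop m T ρ S valid
      where
      open Certificate cert
      drop : ∀ m (T : Fin m → E) {c} ρ → Shrunk (w ∘ T) ρ c →
        (∀ j x → X (T j) x → 0# ≤ c j * (ρ j - w (T j) ∙ x)) →
        ¬ ¬ (∃[ n ] Σ (Fin n → E) λ U → Certificate U × Circuit (w ∘ U))
      drop zero T ρ S valid = contradiction (Shrunk.vanishes S) λ ()
      drop (suc m) T ρ S valid = circuit-certificate {m} {T ∘ punchIn j} record
        { c = c′ ∘ punchIn j
        ; ρ = ρ ∘ punchIn j
        ; dep = λ i → trans (sym (sum-drop (λ l → c′ l * w (T l) i) j
            (trans (*-congʳ c′ⱼ≈0) (zeroˡ (w (T j) i))))) (S.dep i)
        ; negative = λ 0≤ → S.negative (≤-resp refl (sym (sum-drop (λ l → c′ l * ρ l) j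
            (trans (*-congʳ c′ⱼ≈0) (zeroˡ (ρ j))))) 0≤)
        ; valid = λ l x x∈ → refines (punchIn j l) _ (valid (punchIn j l) x x∈)
        }
        where
        module S = Shrunk S
        open S using (c′; vanishes; refines)
        j = proj₁ vanishes
        c′ⱼ≈0 = proj₂ vanishes

    -- Among at least d + 2 vectors, those after the first are already dependent. Extended by a zero
    -- coefficient, this nontrivial dependency contradicts the circuit property.
    circuit-size : ∀ {m} {T : Fin m → E} → Circuit (w ∘ T) → m ℕ.≤ suc d
    circuit-size {m} {T} circuit with m ℕ.≤? suc d
    ... | yes m≤1+d = m≤1+d
    circuit-size {zero}  {T} circuit | no m≰1+d = contradiction z≤n m≰1+d
    circuit-size {suc m} {T} circuit | no m≰1+d = contradiction (λ z → z) (do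
      (c , dep , j , cⱼ≉0) ← dependent (ℕ.s≤s⁻¹ (ℕ.≰⇒> m≰1+d)) (w ∘ T ∘ suc)
      return (cⱼ≉0 (circuit (0# V.∷ c)
        (λ i → trans (+-congʳ (zeroˡ (w (T zero) i))) (trans (+-identityˡ _) (dep i))) zero refl (suc j))))

-- Separating directions and the lines that contain them

module Separation (K : OrderedField) where
  open Order K
  open Linear K
  open Farkas K
  open Circuits K
  open import Relation.Binary.Reasoning.Setoid setoid

  single : ∀ {n} → Fin n → F → Vec n
  single j s l with l Fin.≟ j
  ... | yes _ = s
  ... | no _  = 0#

  single-at : ∀ {n} (j : Fin n) s → single j s j ≈ s
  single-at j s with j Fin.≟ j
  ... | yes _  = refl
  ... | no j≢j = contradiction ≡.refl j≢j

  single-off : ∀ {n} (j : Fin n) s l → l ≢ j → single j s l ≈ 0#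
  single-off j s l l≢j with l Fin.≟ j
  ... | yes l≡j = contradiction l≡j l≢j
  ... | no _    = refl

  single-∙ : ∀ {n} (j : Fin n) s (f : Vec n) → single j s ∙ f ≈ s * f j
  single-∙ j s f = trans
    (sum-single (λ l → single j s l * f l) j λ l l≢j → trans (*-congʳ (single-off j s l l≢j)) (zeroˡ (f l)))
    (*-congʳ (single-at j s))

  sum-single-vector : ∀ {n} (j : Fin n) s → sum (single j s) ≈ s
  sum-single-vector j s = trans (sum-single (single j s) j (single-off j s)) (single-at j s)

  module _ {d N : ℕ} {E : Set} (w : E → Vec d) (X : E → Vec d → Set) (T : Fin N → E) where

    -- Contributions of all constraints proportional to one normal are collected in a single
    -- coefficient `c j`, of either sign, while `r j` bounds their total. The number of summands is
    -- thus that of the normals, however many constraints there are.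
    Derivable : Vec d → F → Set
    Derivable a b = ∃[ c ] ∃[ r ] ((∀ i → lincomb c (w ∘ T) i ≈ a i) × sum r ≤ b ×
      (∀ j x → X (T j) x → c j * w (T j) ∙ x ≤ r j))

    derivable-cone : Cone Derivable
    derivable-cone = record
      { add = λ { (c , r , eq , r≤b , valid) (c′ , r′ , eq′ , r′≤b′ , valid′) →
          (λ j → c j + c′ j) , (λ j → r j + r′ j) ,
          (λ i → trans (sum-cong {N} λ j → distribʳ (w (T j) i) (c j) (c′ j))
            (trans (∑-distrib-+ (λ j → c j * w (T j) i) (λ j → c′ j * w (T j) i)) (+-cong (eq i) (eq′ i)))) ,
          ≤-resp (sym (∑-distrib-+ r r′)) refl (+-mono-≤ r≤b r′≤b′) ,
          λ j x x∈ → ≤-resp (sym (distribʳ (w (T j) ∙ x) (c j) (c′ j))) refl (+-mono-≤ (valid j x x∈) (valid′ j x x∈)) }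
      ; scale = λ { {s} 0≤s (c , r , eq , r≤b , valid) →
          (λ j → s * c j) , (λ j → s * r j) ,
          (λ i → trans (∙-scaleˡ s c (λ j → w (T j) i)) (*-congˡ (eq i))) ,
          ≤-resp (*-distribˡ-sum s r) refl (*-monoˡ-≤ 0≤s r≤b) ,
          λ j x x∈ → ≤-resp (sym (*-assoc s (c j) (w (T j) ∙ x))) refl (*-monoˡ-≤ 0≤s (valid j x x∈)) }
      ; resp = λ { p q (c , r , eq , r≤b , valid) →
          c , r , (λ i → trans (eq i) (p i)) , ≤-resp refl q r≤b , valid }
      }

    derivable-constraint : ∀ {a b} j s → (∀ i → a i ≈ s * w (T j) i) →
      (∀ x → X (T j) x → a ∙ x ≤ b) → Derivable a b
    derivable-constraint {a} {b} j s a≈ a∙x≤b = single j s , single j b ,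
      (λ i → trans (single-∙ j s (λ l → w (T l) i)) (sym (a≈ i))) ,
      ≤-reflexive (sum-single-vector j b) ,
      by-cases j
        (λ x x∈ → ≤-resp (trans (∙-cong a≈ (λ _ → refl)) (trans (∙-scaleˡ s (w (T j)) x) (*-congʳ (sym (single-at j s)))))
          (sym (single-at j b)) (a∙x≤b x x∈))
        (λ l l≢j x x∈ → ≤-reflexive (trans (*-congʳ (single-off j s l l≢j))
          (trans (zeroˡ (w (T l) ∙ x)) (sym (single-off j b l l≢j)))))

    infeasible-certificate : (∀ j → ∃ (X (T j))) → ∀ cs → All (uncurry Derivable) cs →
      ¬ (∃[ x ] All (Sat x) cs) → ¬ ¬ Certificate w X T
    infeasible-certificate nonempty cs derivable infeasible = do
      inj₂ (b , b<0 , c , r , eq , r≤b , valid) ← farkas derivable-cone cs derivable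
        where inj₁ feasible → contradiction feasible infeasible
      thresholds ← ¬¬∀ λ j → threshold (c j) (r j) (w (T j)) (valid j) (nonempty j)
      let ρ = proj₁ ∘ thresholds
      return record
        { c = c
        ; ρ = ρ
        ; dep = eq
        ; negative = ≤-<-trans (≤-trans (sum-mono-≤ (λ j → proj₁ (proj₂ (thresholds j)))) r≤b) b<0
        ; valid = λ j → proj₂ (proj₂ (thresholds j))
        }
      where
      -- For nonzero `c` the threshold is `r / c`. For `c ≈ 0` it may be 0: evaluation at a point of
      -- `S` shows that `r` is nonnegative, and this is where nonemptiness enters.
      threshold : ∀ c r a {S : Vec d → Set} → (∀ x → S x → c * a ∙ x ≤ r) → ∃ S →
        ¬ ¬ (∃[ ρ ] (c * ρ ≤ r × (∀ x → S x → 0# ≤ c * (ρ - a ∙ x))))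
      threshold c r a valid (p , p∈) = do
        no c≉0 ← em {A = c ≈ 0#}
          where yes c≈0 → return (0# ,
                  ≤-resp (trans (*-congʳ c≈0) (trans (zeroˡ (a ∙ p)) (sym (zeroʳ c)))) refl (valid p p∈) ,
                  λ x x∈ → ≤-reflexive (sym (trans (*-congʳ c≈0) (zeroˡ _))))
        (y , cy≈1) ← inverse c≉0
        let cyr≈r = trans (sym (*-assoc c y r)) (trans (*-congʳ cy≈1) (*-identityˡ r))
        return (y * r , ≤-reflexive cyr≈r , λ x x∈ → ≤-resp refl
          (trans (+-congʳ (sym cyr≈r)) (solve 4 (λ c y r z → c :* (y :* r) :- c :* z := c :* (y :* r :- z)) refl c y r (a ∙ x)))
          (x≤y⇒0≤y-x (valid x x∈)))

  module _ {d : ℕ} where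

    -- The thresholds `b < b′` stand in for the endpoints of the two projections, so no supremum or
    -- infimum has to be computed.
    Separates : Vec d → (Vec d → Set) → (Vec d → Set) → Set
    Separates u P Q = ∃[ b ] ∃[ b′ ] (b < b′ × (∀ x → P x → u ∙ x ≤ b) × (∀ x → Q x → b′ ≤ u ∙ x))

    separates-disjoint : ∀ {u P Q x} → Separates u P Q → P x → ¬ Q x
    separates-disjoint (b , b′ , b<b′ , P≤ , ≤Q) x∈P x∈Q = b<b′ (≤-trans (≤Q _ x∈Q) (P≤ _ x∈P))

    -- The axiom that characterises interval orders. Of the two left-hand sets, the one with the
    -- smaller upper threshold lies before both right-hand sets.
    separates-interval-order : ∀ {u P Q P′ Q′} → Separates u P Q → Separates u P′ Q′ →
      ¬ ¬ (Separates u P Q′ ⊎ Separates u P′ Q)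
    separates-interval-order (b , b′ , b<b′ , P≤ , ≤Q) (e , e′ , e<e′ , P′≤ , ≤Q′) = do
      inj₁ b≤e ← ≤-total b e
        where inj₂ e≤b → return (inj₂ (e , b′ , ≤-<-trans e≤b b<b′ , P′≤ , ≤Q))
      return (inj₁ (b , e′ , ≤-<-trans b≤e e<e′ , P≤ , ≤Q′))

    separates-scale : ∀ {u u′ P Q t} → t ≉ 0# → (∀ i → u′ i ≈ t * u i) → Separates u P Q →
      ¬ ¬ (Separates u′ P Q ⊎ Separates u′ Q P)
    separates-scale {u} {u′} {t = t} t≉0 u′≈tu (b , b′ , b<b′ , P≤ , ≤Q) = do
      pos 0<t ← sign t
        where null t≈0 → contradiction t≈0 t≉0
              neg t<0  → return (inj₂ (t * b′ , t * b , *-monoˡ-<-neg t<0 b<b′ ,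
                (λ x x∈ → ≤-resp (sym (u′∙ x)) refl (*-monoˡ-≤-nonPos (<⇒≤ t<0) (≤Q x x∈))) ,
                (λ x x∈ → ≤-resp refl (sym (u′∙ x)) (*-monoˡ-≤-nonPos (<⇒≤ t<0) (P≤ x x∈)))))
      return (inj₁ (t * b , t * b′ , *-monoˡ-< 0<t b<b′ ,
        (λ x x∈ → ≤-resp (sym (u′∙ x)) refl (*-monoˡ-≤ (<⇒≤ 0<t) (P≤ x x∈))) ,
        (λ x x∈ → ≤-resp refl (sym (u′∙ x)) (*-monoˡ-≤ (<⇒≤ 0<t) (≤Q x x∈)))))
      where
      u′∙ : ∀ x → u′ ∙ x ≈ t * u ∙ x
      u′∙ x = trans (∙-cong u′≈tu (λ _ → refl)) (∙-scaleˡ t u x)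

    NonZeroVector : Vec d → Set
    NonZeroVector u = ¬ (∀ i → u i ≈ 0#)

    separates-nonzero : ∀ {u P Q} → ∃ P → ∃ Q → Separates u P Q → NonZeroVector u
    separates-nonzero {u} (p , p∈) (q , q∈) (b , b′ , b<b′ , P≤ , ≤Q) u≈0 =
      b<b′ (≤-trans (≤Q q q∈) (≤-trans (≤-reflexive (trans (u∙≈0 q) (sym (u∙≈0 p)))) (P≤ p p∈)))
      where
      u∙≈0 : ∀ x → u ∙ x ≈ 0#
      u∙≈0 x = sum-zero λ i → trans (*-congʳ (u≈0 i)) (zeroˡ (x i))

    Span : ∀ {m} → (Fin m → Vec d) → Vec d → Set
    Span v u = ∃[ c ] (∀ i → u i ≈ lincomb c v i)

    -- A span depends only on which entries occur, so it is insensitive to the sorting and padding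
    -- done by the encoding.
    span-reindex : ∀ {m n} {E : Set} (f : E → Vec d) {T : Fin m → E} {U : Fin n → E} →
      (∀ j → ∃[ l ] T j ≡ U l) → ∀ {u} → Span (f ∘ T) u → Span (f ∘ U) u
    span-reindex {m} {n} f {T} {U} T⊆U {u} (c , u≈) = lincomb c (λ j → single (g j) 1#) , λ i → begin
      u i                                              ≈⟨ u≈ i ⟩
      lincomb c (f ∘ T) i
        ≈⟨ sum-cong {m} (λ j → *-congˡ (trans (reflexive (≡.cong (λ e → f e i) (proj₂ (T⊆U j))))
             (sym (trans (single-∙ (g j) 1# (λ l → f (U l) i)) (*-identityˡ _))))) ⟩
      sum (λ j → c j * single (g j) 1# ∙ (λ l → f (U l) i))
        ≈⟨ ∙-lincombˡ c (λ j → single (g j) 1#) (λ l → f (U l) i) ⟨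
      lincomb (lincomb c (λ j → single (g j) 1#)) (f ∘ U) i ∎
      where
      g : Fin m → Fin n
      g j = proj₁ (T⊆U j)

  left right : ∀ {A : Set} → A ⊎ A → F → F
  left  (inj₁ _) x = x
  left  (inj₂ _) x = 0#
  right (inj₁ _) x = 0#
  right (inj₂ _) x = x

  left+right : ∀ {A : Set} (e : A ⊎ A) x → left e x + right e x ≈ x
  left+right (inj₁ _) x = +-identityʳ x
  left+right (inj₂ _) x = +-identityˡ x

  -- inj₁ i and inj₂ i stand for the i-th normal, used for the first and for the second polytope.
  module Directions {d k : ℕ} (normal : Fin k → Vec d) where

    w : Fin k ⊎ Fin k → Vec d
    w = [ normal , normal ]′

    -- Zero vectors replace the normals of the other polytope, so that both spans and the dependency
    -- share one index set.
    wˡ wʳ : Fin k ⊎ Fin k → Vec d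
    wˡ e i = left e (w e i)
    wʳ e i = right e (w e i)

    record Line {m} (T : Fin m → Fin k ⊎ Fin k) (u : Vec d) : Set where
      field
        nonzero   : NonZeroVector u
        spanˡ     : Span (wˡ ∘ T) u
        spanʳ     : Span (wʳ ∘ T) u
        spanned   : ∀ v → Span (wˡ ∘ T) v → Span (wʳ ∘ T) v → ¬ ¬ (∃[ t ] (∀ i → v i ≈ t * u i))

    line-reindex : ∀ {m n} {T : Fin m → Fin k ⊎ Fin k} {U : Fin n → Fin k ⊎ Fin k} →
      (∀ j → ∃[ l ] T j ≡ U l) → (∀ l → ∃[ j ] U l ≡ T j) → ∀ {u} → Line T u → Line U u
    line-reindex {T = T} {U} T⊆U U⊆T line = record
      { nonzero = nonzero
      ; spanˡ   = span-reindex wˡ {T} {U} T⊆U spanˡ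
      ; spanʳ   = span-reindex wʳ {T} {U} T⊆U spanʳ
      ; spanned = λ v p q → spanned v (span-reindex wˡ {U} {T} U⊆T p) (span-reindex wʳ {U} {T} U⊆T q)
      }
      where open Line line

    direction : ∀ {m} (T : Fin m → Fin k ⊎ Fin k) →
      ¬ ¬ (∃[ u₀ ] (∀ u → Line T u → ¬ ¬ (∃[ t ] (t ≉ 0# × (∀ i → u₀ i ≈ t * u i)))))
    direction T = do
      yes (u₀ , line₀) ← em {A = ∃[ u ] Line T u}
        -- A tuple without a line still needs a value; the zero vector is harmless, since nothing is
        -- claimed about it.
        where no none → return ((λ _ → 0#) , λ u line → contradiction (u , line) none)
      return (u₀ , λ u line → do
        (t , u₀≈tu) ← Line.spanned line u₀ (Line.spanˡ line₀) (Line.spanʳ line₀)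
        return (t , (λ t≈0 → Line.nonzero line₀ λ i → trans (u₀≈tu i) (trans (*-congʳ t≈0) (zeroˡ (u i)))) , u₀≈tu))

    module _ {P Q : Vec d → Set} (P≢∅ : ∃ P) (Q≢∅ : ∃ Q) {m : ℕ} {T : Fin m → Fin k ⊎ Fin k}
             (cert : Certificate w [ (λ _ → P) , (λ _ → Q) ]′ T) (circuit : Circuit (w ∘ T)) where
      open Certificate cert

      private
        u : Vec d
        u = lincomb c (wˡ ∘ T)

        ρˡ ρʳ : Vec m
        ρˡ j = left (T j) (ρ j)
        ρʳ j = right (T j) (ρ j)

        split : ∀ (f : Vec m) → sum (λ j → c j * left (T j) (f j)) + sum (λ j → c j * right (T j) (f j)) ≈ c ∙ f
        split f = trans (sym (∑-distrib-+ (λ j → c j * left (T j) (f j)) (λ j → c j * right (T j) (f j))))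
          (sum-cong {m} λ j → trans (sym (distribˡ (c j) _ _)) (*-congˡ (left+right (T j) (f j))))

        -u : ∀ i → lincomb c (wʳ ∘ T) i ≈ - u i
        -u i = begin
          lincomb c (wʳ ∘ T) i                   ≈⟨ solve 2 (λ a b → b := (a :+ b) :+ (:- a)) refl (u i) _ ⟩
          u i + lincomb c (wʳ ∘ T) i + - u i     ≈⟨ +-congʳ (trans (split (λ j → w (T j) i)) (dep i)) ⟩
          0# + - u i                             ≈⟨ +-identityˡ (- u i) ⟩
          - u i                                  ∎

      -- The dependency splits into `u`, the part from `P`, and `- u`, the part from `Q`. The
      -- thresholds bound `u` on `P` by `c ∙ ρˡ` and `- u` on `Q` by `c ∙ ρʳ`; the gap between the
      -- two values is `- (c ∙ ρ)`, which is positive.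
      certificate-separates : Separates u P Q
      certificate-separates = c ∙ ρˡ , - (c ∙ ρʳ) ,
        (λ b′≤b → negative (≤-resp (-‿inverseˡ (c ∙ ρʳ)) (trans (+-comm _ _) (split ρ)) (≤-resp (+-comm _ _) refl (+-monoʳ-≤ (c ∙ ρʳ) b′≤b)))) ,
        (λ x x∈P → ≤-resp (sym (∙-lincombˡ c (wˡ ∘ T) x)) refl (sum-mono-≤ λ j → termˡ j (T j) ≡.refl x x∈P)) ,
        (λ x x∈Q → from-diff
          (x≤y⇒0≤y-x (≤-resp (sym (∙-lincombˡ c (wʳ ∘ T) x)) refl (sum-mono-≤ λ j → termʳ j (T j) ≡.refl x x∈Q)))
          (trans (solve 2 (λ a b → a :- (:- b) := b :- (:- a)) refl (u ∙ x) (c ∙ ρʳ))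
            (+-congˡ (-‿cong (sym (trans (∙-cong -u (λ _ → refl)) (neg-∙ x)))))))
        where
        neg-∙ : ∀ x → (λ i → - u i) ∙ x ≈ - (u ∙ x)
        neg-∙ x = trans (∙-cong (λ i → sym (-1*x≈-x (u i))) (λ _ → refl))
          (trans (∙-scaleˡ (- 1#) u x) (-1*x≈-x (u ∙ x)))
        valid-at : ∀ j e → T j ≡ e → ∀ x → [ (λ _ → P) , (λ _ → Q) ]′ e x → 0# ≤ c j * (ρ j - w e ∙ x)
        valid-at j e ≡.refl = valid j
        0∙ : ∀ c (x : Vec d) → c * (λ i → 0#) ∙ x ≈ c * 0#
        0∙ c x = *-congˡ (sum-zero λ i → zeroˡ (x i))
        bound : ∀ {c ρ z} → 0# ≤ c * (ρ - z) → c * z ≤ c * ρ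
        bound {c} {ρ} {z} p = from-diff p (solve 3 (λ c ρ z → c :* ρ :- c :* z := c :* (ρ :- z)) refl c ρ z)
        termˡ : ∀ j e → T j ≡ e → ∀ x → P x → c j * wˡ e ∙ x ≤ c j * left e (ρ j)
        termˡ j (inj₁ i) eq x x∈P = bound (valid-at j (inj₁ i) eq x x∈P)
        termˡ j (inj₂ i) eq x x∈P = ≤-reflexive (0∙ (c j) x)
        termʳ : ∀ j e → T j ≡ e → ∀ x → Q x → c j * wʳ e ∙ x ≤ c j * right e (ρ j)
        termʳ j (inj₁ i) eq x x∈Q = ≤-reflexive (0∙ (c j) x)
        termʳ j (inj₂ i) eq x x∈Q = bound (valid-at j (inj₂ i) eq x x∈Q)

      private
        u≉0 : NonZeroVector u
        u≉0 = separates-nonzero {u = u} {P} {Q} P≢∅ Q≢∅ certificate-separates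

      -- With no normal taken from `P`, the vector `u` would be an empty combination, hence zero,
      -- and could not separate nonempty sets.
      certificate-left : ¬ (∀ j → ∃[ i ] T j ≡ inj₂ i)
      certificate-left all-right = u≉0 λ i → sum-zero λ j → vanish i j (all-right j)
        where
        vanish : ∀ i j → (∃[ l ] T j ≡ inj₂ l) → c j * wˡ (T j) i ≈ 0#
        vanish i j (l , eq) = trans (*-congˡ (reflexive (≡.cong (λ e → wˡ e i) eq))) (zeroʳ (c j))

      certificate-right : ¬ (∀ j → ∃[ i ] T j ≡ inj₁ i)
      certificate-right all-left = u≉0 λ i → trans (sym (-‿involutive (u i)))
        (trans (-‿cong (trans (sym (-u i)) (sum-zero λ j → vanish i j (all-left j)))) -0#≈0#)
        where
        vanish : ∀ i j → (∃[ l ] T j ≡ inj₁ l) → c j * wʳ (T j) i ≈ 0#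
        vanish i j (l , eq) = trans (*-congˡ (reflexive (≡.cong (λ e → wʳ e i) eq))) (zeroʳ (c j))

      -- Two representations of v, on the left and on the right, form a dependency,
      -- which in a circuit is a multiple of c.
      certificate-line : Line T u
      certificate-line = record
        { nonzero = u≉0
        ; spanˡ   = c , λ i → refl
        ; spanʳ   = (λ j → - 1# * c j) , λ i → sym (trans (∙-scaleˡ (- 1#) c (λ j → wʳ (T j) i))
            (trans (*-congˡ (-u i)) (trans (-1*x≈-x (- u i)) (-‿involutive (u i)))))
        ; spanned = spanned
        }
        where
        spanned : ∀ v → Span (wˡ ∘ T) v → Span (wʳ ∘ T) v → ¬ ¬ (∃[ t ] (∀ i → v i ≈ t * u i))
        spanned v (α , v≈α) (β , v≈β) = do
          (i₀ , uᵢ≉0) ← nonzero-coordinate u u≉0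
          (j , cⱼ≉0) ← nonzero-coordinate c λ c≈0 → uᵢ≉0 (sum-zero λ j → trans (*-congʳ (c≈0 j)) (zeroˡ _))
          (y , cⱼy≈1) ← inverse cⱼ≉0
          -- Since `y` inverts `c j`, this multiple makes `e - t c` vanish at `j`; the circuit
          -- property then makes it vanish everywhere.
          let t = e j * y
              e-tc : ∀ l → 1# * e l + - t * c l ≈ 0#
              e-tc = circuit (λ l → 1# * e l + - t * c l) (Dependency-linear 1# (- t) e c (w ∘ T) dep-e dep) j (begin
                1# * e j + - (e j * y) * c j    ≈⟨ +-cong (*-identityˡ (e j)) (solve 3 (λ e y c → (:- (e :* y)) :* c := :- (e :* (c :* y))) refl (e j) y (c j)) ⟩
                e j - e j * (c j * y)           ≈⟨ +-congˡ (-‿cong (trans (*-congˡ cⱼy≈1) (*-identityʳ (e j)))) ⟩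
                e j - e j                       ≈⟨ -‿inverseʳ (e j) ⟩
                0#                              ∎)
              e≈tc : ∀ l → e l ≈ t * c l
              e≈tc = λ l → x-y≈0⇒x≈y (trans (+-cong (sym (*-identityˡ (e l))) (solve 2 (λ t c → :- (t :* c) := (:- t) :* c) refl t (c l))) (e-tc l))
          return (t , λ i → begin
            v i                             ≈⟨ v≈α i ⟩
            lincomb α (wˡ ∘ T) i            ≈⟨ sum-cong {m} (λ l → e-left (T l) (α l) (β l) i) ⟨
            lincomb e (wˡ ∘ T) i            ≈⟨ sum-cong {m} (λ l → *-congʳ (e≈tc l)) ⟩
            lincomb (λ l → t * c l) (wˡ ∘ T) i ≈⟨ ∙-scaleˡ t c (λ j → wˡ (T j) i) ⟩
            t * u i                         ∎)
          where
          e : Vec m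
          e l = left (T l) (α l) + - right (T l) (β l)
          e-left : ∀ T a b i → (left T a + - right T b) * wˡ T i ≈ a * wˡ T i
          e-left (inj₁ _) a b i = *-congʳ (trans (+-congˡ -0#≈0#) (+-identityʳ a))
          e-left (inj₂ _) a b i = trans (zeroʳ _) (sym (zeroʳ a))
          e-term : ∀ T a b i → (left T a + - right T b) * w T i ≈ 1# * (a * wˡ T i) + - 1# * (b * wʳ T i)
          e-term (inj₁ l) a b i = trans (*-congʳ (trans (+-congˡ -0#≈0#) (+-identityʳ a)))
            (sym (trans (+-cong (*-identityˡ _) (trans (*-congˡ (zeroʳ b)) (zeroʳ (- 1#)))) (+-identityʳ _)))
          e-term (inj₂ l) a b i = trans (*-congʳ (+-identityˡ (- b)))
            (sym (trans (+-cong (trans (*-congˡ (zeroʳ a)) (zeroʳ 1#)) (-1*x≈-x _)) (trans (+-identityˡ _)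
              (solve 2 (λ b n → :- (b :* n) := (:- b) :* n) refl b (normal l i)))))
          dep-e : Dependency (w ∘ T) e
          dep-e i = begin
            lincomb e (w ∘ T) i
              ≈⟨ sum-cong {m} (λ l → e-term (T l) (α l) (β l) i) ⟩
            sum (λ l → 1# * (α l * wˡ (T l) i) + - 1# * (β l * wʳ (T l) i))
              ≈⟨ sum-linear 1# (- 1#) (λ l → α l * wˡ (T l) i) (λ l → β l * wʳ (T l) i) ⟩
            1# * lincomb α (wˡ ∘ T) i + - 1# * lincomb β (wʳ ∘ T) i
              ≈⟨ +-cong (trans (*-identityˡ _) (sym (v≈α i))) (trans (-1*x≈-x _) (-‿cong (sym (v≈β i)))) ⟩
            v i - v i
              ≈⟨ -‿inverseʳ (v i) ⟩
            0# ∎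

unique-lookup : ∀ {A : Set} {xs : List A} → Unique xs → ∀ {i j} → i Fin.< j → lookup xs i ≢ lookup xs j
unique-lookup (x∉ ∷ _) {zero}  {suc j} _         = All.lookup x∉ (∈-lookup j)
unique-lookup (_ ∷ uq) {suc i} {suc j} (s≤s i<j) = unique-lookup uq i<j

-- Maximal cliques of intersections of interval graphs

module MaximalCliques {n D : ℕ} (G : Graph n) (_≺[_]_ : Fin n → Fin D → Fin n → Set)
  (≺-interval : ∀ {e u v u′ v′} → u ≺[ e ] v → u′ ≺[ e ] v′ → ¬ ¬ (u ≺[ e ] v′ ⊎ u′ ≺[ e ] v))
  (≺-irrefl : ∀ {e u} → ¬ u ≺[ e ] u)
  (adjacent⇒⊀ : ∀ {e u v} → Graph._~_ G u v → ¬ u ≺[ e ] v)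
  (comparable : ∀ u v → u ≢ v → Graph._~_ G u v ⊎ ∃[ e ] (u ≺[ e ] v ⊎ v ≺[ e ] u))
  where
  open Graph G

  -- In an interval representation of ≺[ e ], the left endpoint of u is not to the right of that of v.
  _⊑[_]_ : Fin n → Fin D → Fin n → Set
  u ⊑[ e ] v = ∀ x → x ≺[ e ] u → ¬ ¬ x ≺[ e ] v

  -- If some `x` precedes `u` but not `v`, the interval axiom applied to `x ≺ u` and any `y ≺ v`
  -- leaves only `y ≺ u`.
  ⊑-total : ∀ e u v → ¬ ¬ (v ⊑[ e ] u ⊎ u ⊑[ e ] v)
  ⊑-total e u v = do
    yes (x , x≺u , x⊀v) ← em {A = ∃[ x ] (x ≺[ e ] u × ¬ x ≺[ e ] v)}
      where no none → return (inj₂ λ x x≺u x⊀v → none (x , x≺u , x⊀v))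
    return (inj₁ λ y y≺v → do
      inj₂ y≺u ← ≺-interval x≺u y≺v
        where inj₁ x≺v → contradiction x≺v x⊀v
      return y≺u)

  Rightmost : Subset n → Fin D → Fin n → Set
  Rightmost C e v = v ∈ C × (∀ u → u ∈ C → u ⊑[ e ] v)

  rightmost : ∀ C → Nonempty C → ∀ e → ¬ ¬ ∃ (Rightmost C e)
  rightmost C C≢∅ e = minimum (λ v u → u ⊑[ e ] v) (λ _ _ → return)
    (λ j⊑i l⊑j x x≺l → l⊑j x x≺l >>= j⊑i x) (⊑-total e) (_∈ C) C≢∅

  module _ {C C′ : Subset n} (v : Fin D → Fin n)
    (C-clique : IsClique G C) (C′-clique : IsClique G C′)
    (C-right : ∀ e → Rightmost C e (v e)) (C′-right : ∀ e → Rightmost C′ e (v e)) where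

    private
      ⊀v : ∀ {B} → IsClique G B → (∀ e → Rightmost B e (v e)) → ∀ {u} → u ∈ B → ∀ e → ¬ u ≺[ e ] v e
      ⊀v clique right {u} u∈ e u≺v with u Fin.≟ v e
      ... | yes ≡.refl = ≺-irrefl u≺v
      ... | no u≢v     = adjacent⇒⊀ (clique u∈ (proj₁ (right e)) u≢v) u≺v

      ∪-⊀v : ∀ {u} → u ∈ C ∪ C′ → ∀ e → ¬ u ≺[ e ] v e
      ∪-⊀v u∈ = [ ⊀v C-clique C-right , ⊀v C′-clique C′-right ]′ (x∈p∪q⁻ C C′ u∈)

      ∪-⊑v : ∀ {u} → u ∈ C ∪ C′ → ∀ e → u ⊑[ e ] v e
      ∪-⊑v u∈ e = [ proj₂ (C-right e) _ , proj₂ (C′-right e) _ ]′ (x∈p∪q⁻ C C′ u∈)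

    -- For each e, the intervals of all members of C ∪ C′ contain the left endpoint of v e.
    ∪-clique : IsClique G (C ∪ C′)
    ∪-clique {u} {u′} u∈ u′∈ u≢u′ with comparable u u′ u≢u′
    ... | inj₁ u~u′              = u~u′
    ... | inj₂ (e , inj₁ u≺u′) = contradiction (∪-⊀v u∈ e) (∪-⊑v u′∈ e u u≺u′)
    ... | inj₂ (e , inj₂ u′≺u) = contradiction (∪-⊀v u′∈ e) (∪-⊑v u∈ e u′ u′≺u)

  -- The empty clique is contained in any singleton, which is a clique as well.
  maximalClique-nonempty : ∀ {C} → Fin n → IsMaximalClique G C → Nonempty C
  maximalClique-nonempty {C} v (_ , maximal) with nonempty? C
  ... | yes C≢∅ = C≢∅
  ... | no C≡∅  = contradiction (v , ≡.subst (v ∈_) (≡.sym C≡⁅v⁆) (x∈⁅x⁆ v)) C≡∅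
    where
    C≡⁅v⁆ : C ≡ ⁅ v ⁆
    C≡⁅v⁆ = maximal ⁅ v ⁆
      (λ x∈ y∈ x≢y → contradiction (≡.trans (x∈⁅y⁆⇒x≡y v x∈) (≡.sym (x∈⁅y⁆⇒x≡y v y∈))) x≢y)
      (λ x∈C → contradiction (_ , x∈C) C≡∅)

  -- Pigeonhole on the tuple of rightmost members, one for each direction: if two cliques have the
  -- same tuple, their union is a clique, and by maximality both equal it.
  maximalCliques-bound : Fin n → ∀ Cs → Unique Cs → All (IsMaximalClique G) Cs → length Cs ℕ.≤ n ℕ.^ D
  maximalCliques-bound v₀ Cs unique maximal = ℕ.≮⇒≥ λ n^D<∣Cs∣ → (do
    v ← ¬¬∀ λ a → ¬¬∀ λ e → rightmost (lookup Cs a) (maximalClique-nonempty v₀ (maximal-at a)) e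
    let code : Fin (length Cs) → Fin (n ℕ.^ D)
        code a = funToFin λ e → proj₁ (v a e)
        (a , b , a<b , code-eq) = Fin.pigeonhole n^D<∣Cs∣ code
        same : ∀ e → proj₁ (v b e) ≡ proj₁ (v a e)
        same = λ e → ≡.trans (≡.sym (Fin.finToFun-funToFin (proj₁ ∘ v b) e))
          (≡.trans (≡.cong (λ c → finToFun c e) (≡.sym code-eq)) (Fin.finToFun-funToFin (proj₁ ∘ v a) e))
        clique = ∪-clique (proj₁ ∘ v a) (proj₁ (maximal-at a)) (proj₁ (maximal-at b))
          (proj₂ ∘ v a) (λ e → ≡.subst (Rightmost (lookup Cs b) e) (same e) (proj₂ (v b e)))
    return (unique-lookup unique a<b (≡.trans
      (proj₂ (maximal-at a) _ clique (p⊆p∪q (lookup Cs b)))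
      (≡.sym (proj₂ (maximal-at b) _ clique (q⊆p∪q (lookup Cs a) (lookup Cs b))))))) id
    where
    maximal-at : ∀ a → IsMaximalClique G (lookup Cs a)
    maximal-at a = All.lookup maximal (∈-lookup a)

-- Encoding of the candidate directions

module _ {k : ℕ} where

  -- The non-strict comparison sends positions 0 to `i` to the left. As `i` ranges over `Fin d`,
  -- this gives 1 to d left entries, and at least one of the d + 1 positions stays on the right.
  sorted : ∀ {d} → Fin d → (Fin (d ℕ.+ 1) → Fin k) → Fin (d ℕ.+ 1) → Fin k ⊎ Fin k
  sorted i f l with toℕ l ℕ.≤? toℕ i
  ... | yes _ = inj₁ (f l)
  ... | no _  = inj₂ (f l)

  sorted-left : ∀ {d} (i : Fin d) f {l} → toℕ l ℕ.≤ toℕ i → sorted i f l ≡ inj₁ (f l)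
  sorted-left i f {l} l≤i with toℕ l ℕ.≤? toℕ i
  ... | yes _  = ≡.refl
  ... | no l≰i = contradiction l≤i l≰i

  sorted-right : ∀ {d} (i : Fin d) f {l} → toℕ i ℕ.< toℕ l → sorted i f l ≡ inj₂ (f l)
  sorted-right i f {l} i<l with toℕ l ℕ.≤? toℕ i
  ... | yes l≤i = contradiction l≤i (ℕ.<⇒≱ i<l)
  ... | no _    = ≡.refl

  decode : ∀ {d} → Fin (d ℕ.* k ℕ.^ (d ℕ.+ 1)) → Fin (d ℕ.+ 1) → Fin k ⊎ Fin k
  decode {d} e = let i , c = remQuot {d} (k ℕ.^ (d ℕ.+ 1)) e in sorted i (finToFun c)

  module _ {d : ℕ} (i : Fin d) (f : Fin (d ℕ.+ 1) → Fin k) where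

    encode : Fin (d ℕ.* k ℕ.^ (d ℕ.+ 1))
    encode = combine i (funToFin f)

    private
      decode-encode : ∀ l → decode {d} encode l ≡ sorted i (finToFun (funToFin f)) l
      decode-encode l = ≡.cong (λ (j , c) → sorted j (finToFun c) l) (Fin.remQuot-combine i (funToFin f))

    decode-left : ∀ {l} → toℕ l ℕ.≤ toℕ i → decode {d} encode l ≡ inj₁ (f l)
    decode-left {l} l≤i = ≡.trans (decode-encode l)
      (≡.trans (sorted-left i _ l≤i) (≡.cong inj₁ (Fin.finToFun-funToFin f l)))

    decode-right : ∀ {l} → toℕ i ℕ.< toℕ l → decode {d} encode l ≡ inj₂ (f l)
    decode-right {l} i<l = ≡.trans (decode-encode l)
      (≡.trans (sorted-right i _ i<l) (≡.cong inj₂ (Fin.finToFun-funToFin f l)))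

-- The default returned beyond the end of the list is what pads short tuples.
nth : ∀ {A : Set} → A → List A → ℕ → A
nth y []       n       = y
nth y (x ∷ xs) zero    = x
nth y (x ∷ xs) (suc n) = nth y xs n

module _ {A : Set} {y : A} where

  nth-∈ : ∀ ys n → y List.∈ ys → nth y ys n List.∈ ys
  nth-∈ ys n y∈ys with go ys n
    where
    go : ∀ ys n → nth y ys n List.∈ y ∷ ys
    go []       n       = here ≡.refl
    go (x ∷ xs) zero    = there (here ≡.refl)
    go (x ∷ xs) (suc n) with go xs n
    ... | here eq = here eq
    ... | there m = there (there m)
  ... | here eq = ≡.subst (List._∈ ys) (≡.sym eq) y∈ys
  ... | there m = m

  nth-++ˡ : ∀ xs {ys n} → n ℕ.< length xs → nth y (xs ++ ys) n List.∈ xs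
  nth-++ˡ (x ∷ xs) {n = zero}  _         = here ≡.refl
  nth-++ˡ (x ∷ xs) {n = suc n} (s≤s n<) = there (nth-++ˡ xs n<)

  nth-++ʳ : ∀ xs {ys n} → y List.∈ ys → length xs ℕ.≤ n → nth y (xs ++ ys) n List.∈ ys
  nth-++ʳ []       {n = n} y∈ys _         = nth-∈ _ n y∈ys
  nth-++ʳ (x ∷ xs) y∈ys (s≤s ≤n) = nth-++ʳ xs y∈ys ≤n

  ∈⇒nth : ∀ {x xs} → x List.∈ xs → ∀ ys → ∃[ n ] (n ℕ.< length xs × nth y (xs ++ ys) n ≡ x)
  ∈⇒nth (here ≡.refl) ys = 0 , s≤s z≤n , ≡.refl
  ∈⇒nth (there x∈) ys    = let n , n< , eq = ∈⇒nth x∈ ys in suc n , s≤s n< , eq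

  ∈⇒nthʳ : ∀ xs {z ys} → z List.∈ ys → ∃[ n ] (n ℕ.< length ys × nth y (xs ++ ys) (length xs ℕ.+ n) ≡ z)
  ∈⇒nthʳ []       (here ≡.refl) = 0 , s≤s z≤n , ≡.refl
  ∈⇒nthʳ []       (there z∈)    = let n , n< , eq = ∈⇒nthʳ [] z∈ in suc n , s≤s n< , eq
  ∈⇒nthʳ (x ∷ xs) z∈            = ∈⇒nthʳ xs z∈

record Sides {A : Set} {m} (T : Fin m → A ⊎ A) : Set where
  field
    lefts rights : List A
    size         : length lefts ℕ.+ length rights ≡ m
    ∈-lefts      : ∀ j {x} → T j ≡ inj₁ x → x List.∈ lefts
    ∈-rights     : ∀ j {x} → T j ≡ inj₂ x → x List.∈ rights
    lefts-∈      : ∀ {x} → x List.∈ lefts → ∃[ j ] inj₁ x ≡ T j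
    rights-∈     : ∀ {x} → x List.∈ rights → ∃[ j ] inj₂ x ≡ T j

sides : ∀ {A : Set} {m} (T : Fin m → A ⊎ A) → Sides T
sides {m = zero} T = record
  { lefts = [] ; rights = [] ; size = ≡.refl
  ; ∈-lefts = λ () ; ∈-rights = λ () ; lefts-∈ = λ () ; rights-∈ = λ () }
sides {m = suc m} T with T zero in eq | sides (T ∘ suc)
... | inj₁ x | S = record
  { lefts = x ∷ lefts ; rights = rights ; size = ≡.cong suc size
  ; ∈-lefts  = λ { zero eq′ → here (inj₁-injective (≡.trans (≡.sym eq′) eq)) ; (suc j) eq′ → there (∈-lefts j eq′) }
  ; ∈-rights = λ { zero eq′ → contradiction (≡.trans (≡.sym eq) eq′) λ () ; (suc j) eq′ → ∈-rights j eq′ }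
  ; lefts-∈  = λ { (here ≡.refl) → zero , ≡.sym eq ; (there m) → let j , p = lefts-∈ m in suc j , p }
  ; rights-∈ = λ m → let j , p = rights-∈ m in suc j , p
  } where open Sides S
... | inj₂ x | S = record
  { lefts = lefts ; rights = x ∷ rights ; size = ≡.trans (ℕ.+-suc _ _) (≡.cong suc size)
  ; ∈-lefts  = λ { zero eq′ → contradiction (≡.trans (≡.sym eq) eq′) λ () ; (suc j) eq′ → ∈-lefts j eq′ }
  ; ∈-rights = λ { zero eq′ → here (inj₂-injective (≡.trans (≡.sym eq′) eq)) ; (suc j) eq′ → there (∈-rights j eq′) }
  ; lefts-∈  = λ m → let j , p = lefts-∈ m in suc j , p
  ; rights-∈ = λ { (here ≡.refl) → zero , ≡.sym eq ; (there m) → let j , p = rights-∈ m in suc j , p }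
  } where open Sides S

-- Tuples with fewer than d + 1 entries are padded by repeating an entry on the right.
decode-surjective : ∀ {d k m} (T : Fin m → Fin k ⊎ Fin k) → m ℕ.≤ d ℕ.+ 1 →
  ¬ (∀ j → ∃[ x ] T j ≡ inj₂ x) → ¬ (∀ j → ∃[ x ] T j ≡ inj₁ x) →
  ∃[ e ] ((∀ j → ∃[ l ] T j ≡ decode {k} {d} e l) × (∀ l → ∃[ j ] decode {k} {d} e l ≡ T j))
decode-surjective {d} {k} {m} T m≤d+1 ¬right ¬left = encoded (sides T)
  where
  encoded : Sides T → ∃[ e ] ((∀ j → ∃[ l ] T j ≡ decode {k} {d} e l) × (∀ l → ∃[ j ] decode {k} {d} e l ≡ T j))
  encoded record { lefts = [] ; ∈-lefts = ∈-lefts } = contradiction all-right ¬right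
    where
    all-right : ∀ j → ∃[ x ] T j ≡ inj₂ x
    all-right j with T j in eq
    ... | inj₁ x = contradiction (∈-lefts j eq) λ ()
    ... | inj₂ x = x , ≡.refl
  encoded record { lefts = _ ∷ _ ; rights = [] ; ∈-rights = ∈-rights } = contradiction all-left ¬left
    where
    all-left : ∀ j → ∃[ x ] T j ≡ inj₁ x
    all-left j with T j in eq
    ... | inj₁ x = x , ≡.refl
    ... | inj₂ x = contradiction (∈-rights j eq) λ ()
  encoded record { lefts = x ∷ xs ; rights = y ∷ ys ; size = size ; ∈-lefts = ∈-lefts ; ∈-rights = ∈-rights
                 ; lefts-∈ = lefts-∈ ; rights-∈ = rights-∈ } = encode i f , T⊆ , ⊆T
    where
    size≤ : suc (length xs) ℕ.+ suc (length ys) ℕ.≤ d ℕ.+ 1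
    size≤ = ℕ.≤-trans (ℕ.≤-reflexive size) m≤d+1
    ∣xs∣<d : length xs ℕ.< d
    ∣xs∣<d = ℕ.+-cancelʳ-≤ 1 _ _ (ℕ.≤-trans (ℕ.+-monoʳ-≤ (suc (length xs)) (s≤s z≤n)) size≤)
    -- This cut puts exactly the positions of `x ∷ xs` on the left. It is below d because the entry
    -- `y` takes up at least one further position.
    i : Fin d
    i = fromℕ< ∣xs∣<d
    toℕ-i : toℕ i ≡ length xs
    toℕ-i = Fin.toℕ-fromℕ< ∣xs∣<d
    entry : ℕ → Fin k
    entry = nth y ((x ∷ xs) ++ (y ∷ ys))
    f : Fin (d ℕ.+ 1) → Fin k
    f l = entry (toℕ l)
    position : ∀ {n} → n ℕ.< suc (length xs) ℕ.+ suc (length ys) → ∃[ l ] toℕ {d ℕ.+ 1} l ≡ n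
    position n< = fromℕ< (ℕ.≤-trans n< size≤) , Fin.toℕ-fromℕ< (ℕ.≤-trans n< size≤)
    T⊆ : ∀ j → ∃[ l ] T j ≡ decode {k} {d} (encode i f) l
    T⊆ j with T j in eq
    ... | inj₁ z =
      let n , n< , nth≡z = ∈⇒nth {y = y} (∈-lefts j eq) (y ∷ ys)
          l , l≡n = position (ℕ.≤-trans n< (ℕ.m≤m+n _ _))
      in l , ≡.trans (≡.cong inj₁ (≡.sym (≡.trans (≡.cong entry l≡n) nth≡z)))
           (≡.sym (decode-left i f (≡.subst₂ ℕ._≤_ (≡.sym l≡n) (≡.sym toℕ-i) (ℕ.s≤s⁻¹ n<))))
    ... | inj₂ z =
      let n , n< , nth≡z = ∈⇒nthʳ {y = y} (x ∷ xs) (∈-rights j eq)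
          l , l≡n = position (ℕ.+-monoʳ-< (suc (length xs)) n<)
      in l , ≡.trans (≡.cong inj₂ (≡.sym (≡.trans (≡.cong entry l≡n) nth≡z)))
           (≡.sym (decode-right i f (≡.subst₂ ℕ._<_ (≡.sym toℕ-i) (≡.sym l≡n) (s≤s (ℕ.m≤m+n _ _)))))
    ⊆T : ∀ l → ∃[ j ] decode {k} {d} (encode i f) l ≡ T j
    ⊆T l with toℕ l ℕ.≤? toℕ i
    ... | yes l≤i =
      let j , eq = lefts-∈ (nth-++ˡ {y = y} (x ∷ xs) (s≤s (≡.subst (toℕ l ℕ.≤_) toℕ-i l≤i)))
      in j , ≡.trans (decode-left i f l≤i) eq
    ... | no l≰i =
      let j , eq = rights-∈ (nth-++ʳ {y = y} (x ∷ xs) (here ≡.refl) (≡.subst (ℕ._< toℕ l) toℕ-i (ℕ.≰⇒> l≰i)))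
      in j , ≡.trans (decode-right i f (ℕ.≰⇒> l≰i)) eq

-- Facets of polytopes

module Polyhedra (K : OrderedField) where
  open Order K
  open Linear K
  open Farkas K
  open Circuits K
  open Separation K
  open import Relation.Binary.Reasoning.Setoid setoid

  Strict : ∀ {d} → Vec d → Constraint d → Set
  Strict x (a , b) = a ∙ x < b

  module _ {d : ℕ} {s t : F} (s+t≈1 : s + t ≈ 1#) (a x y : Vec d) {b : F} where
    private
      mixed : Vec d
      mixed i = s * x i + t * y i
      b-split : s * b + t * b ≈ b
      b-split = trans (sym (distribʳ b s t)) (trans (*-congʳ s+t≈1) (*-identityˡ b))

    convex-sat : 0# ≤ s → 0# ≤ t → a ∙ x ≤ b → a ∙ y ≤ b → a ∙ mixed ≤ b
    convex-sat 0≤s 0≤t p q = ≤-resp (sym (∙-linearʳ s t a x y)) b-split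
      (+-mono-≤ (*-monoˡ-≤ 0≤s p) (*-monoˡ-≤ 0≤t q))

    convex-strict : 0# < s → 0# ≤ t → a ∙ x < b → a ∙ y ≤ b → a ∙ mixed < b
    convex-strict 0<s 0≤t p q = <-resp (sym (∙-linearʳ s t a x y)) b-split
      (+-mono-<-≤ (*-monoˡ-< 0<s p) (*-monoˡ-≤ 0≤t q))

  halves : ¬ ¬ (∃[ h ] (0# < h × h + h ≈ 1#))
  halves = do
    (h , 0<h , 2h≈1) ← inverse-pos (λ 2≤0 → 0<1 (≤-trans (≤-resp (+-identityʳ 1#) refl (+-monoʳ-≤ 1# (<⇒≤ 0<1))) 2≤0))
    return (h , 0<h , trans (sym (trans (distribʳ h 1# 1#) (+-cong (*-identityˡ h) (*-identityˡ h)))) 2h≈1)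

  -- The d + 1 independent points cannot all lie on one bounding hyperplane, so one of them is
  -- strict for the given constraint. Its midpoint with a point strict for the later constraints in
  -- the list is strict for all of these.
  interior-point : ∀ {d} (p : Fin (suc d) → Vec d) → AffinelyIndependent p → ∀ cs →
    All (NonZeroVector ∘ proj₁) cs → (∀ j → All (Sat (p j)) cs) → ¬ ¬ (∃[ z ] All (Strict z) cs)
  interior-point {d} p independent cs₀ nonzero sat = do
    (z , _ , strict) ← go cs₀ nonzero id
    return (z , strict)
    where
    go : ∀ cs → All (NonZeroVector ∘ proj₁) cs → (∀ {x} → All (Sat x) cs₀ → All (Sat x) cs) →
      ¬ ¬ (∃[ z ] (All (Sat z) cs₀ × All (Strict z) cs))
    go [] [] _ = return (p zero , sat zero , [])
    go ((a , b) ∷ cs) (a≉0 ∷ nonzero) sub = do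
      (z , z-sat , z-strict) ← go cs nonzero (λ s → All.tail (sub s))
      (h , 0<h , h+h≈1) ← halves
      yes (j , p-strict) ← em {A = ∃[ j ] a ∙ p j < b}
        where no none → (do
                (i , aᵢ≉0) ← nonzero-coordinate a a≉0
                contradiction independent (hyperplane-dependent aᵢ≉0 p λ j →
                  ≤-antisym (All.head (sub (sat j))) (≤-stable λ b≰ → none (j , λ b≤ → b≰ b≤))))
      return ((λ i → h * p j i + h * z i) ,
        All.zipWith (λ { {a , b} (s , t) → convex-sat h+h≈1 a (p j) z (<⇒≤ 0<h) (<⇒≤ 0<h) s t }) (sat j , z-sat) ,
        convex-strict h+h≈1 a (p j) z 0<h (<⇒≤ 0<h) p-strict (All.head (sub z-sat)) ∷
        All.zipWith (λ { {a , b} (s , t) → <-resp (∙-cong {a = a} (λ _ → refl) (λ i → +-comm _ _)) refl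
          (convex-strict h+h≈1 a z (p j) 0<h (<⇒≤ 0<h) t s) }) (All.tail (sub (sat j)) , z-strict))

  Small : (F → Set) → Set
  Small Q = ∃[ ε ] (0# < ε × (∀ δ → 0# ≤ δ → δ ≤ ε → Q δ))

  small-× : ∀ {Q R : F → Set} → Small Q → Small R → ¬ ¬ Small (λ δ → Q δ × R δ)
  small-× (ε , 0<ε , q) (η , 0<η , r) = do
    inj₁ ε≤η ← ≤-total ε η
      where inj₂ η≤ε → return (η , 0<η , λ δ 0≤δ δ≤η → q δ 0≤δ (≤-trans δ≤η η≤ε) , r δ 0≤δ δ≤η)
    return (ε , 0<ε , λ δ 0≤δ δ≤ε → q δ 0≤δ δ≤ε , r δ 0≤δ (≤-trans δ≤ε ε≤η))

  small-All : ∀ {A : Set} {Q : A → F → Set} {xs} → All (λ x → ¬ ¬ Small (Q x)) xs →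
    ¬ ¬ Small (λ δ → All (λ x → Q x δ) xs)
  small-All [] = return (1# , 0<1 , λ _ _ _ → [])
  small-All (s ∷ ss) = do
    q ← s
    qs ← small-All ss
    (ε , 0<ε , h) ← small-× q qs
    return (ε , 0<ε , λ δ 0≤δ δ≤ε → let p , ps = h δ 0≤δ δ≤ε in p ∷ ps)

  small-∀ : ∀ {n} {Q : Fin n → F → Set} → (∀ i → ¬ ¬ Small (Q i)) → ¬ ¬ Small (λ δ → ∀ i → Q i δ)
  small-∀ {zero}  s = return (1# , 0<1 , λ _ _ _ ())
  small-∀ {suc n} s = do
    q ← s zero
    qs ← small-∀ (s ∘ suc)
    (ε , 0<ε , h) ← small-× q qs
    return (ε , 0<ε , λ { δ 0≤δ δ≤ε zero → proj₁ (h δ 0≤δ δ≤ε) ; δ 0≤δ δ≤ε (suc i) → proj₂ (h δ 0≤δ δ≤ε) i })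

  small-move : ∀ {d} (x v : Vec d) {c} → Strict x c → ¬ ¬ Small (λ δ → Sat (λ i → 1# * x i + δ * v i) c)
  small-move x v {a , b} strict = do
    no 0<g ← em {A = a ∙ v ≤ 0#}
      where yes g≤0 → return (1# , 0<1 , λ δ 0≤δ _ → moved δ (≤-trans
              (≤-resp refl (zeroʳ δ) (*-monoˡ-≤ 0≤δ g≤0)) (x≤y⇒0≤y-x (<⇒≤ strict))))
    (y , 0<y , gy≈1) ← inverse-pos 0<g
    let slack = b - a ∙ x
    -- The step length is the slack divided by `a ∙ v`, the distance at which the constraint becomes
    -- tight.
    return (slack * y ,
      *-pos (λ s≤0 → strict (x-y≤0⇒x≤y s≤0)) 0<y ,
      λ δ 0≤δ δ≤ → moved δ (≤-resp (*-comm (a ∙ v) δ)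
        (trans (solve 3 (λ g s y → g :* (s :* y) := s :* (g :* y)) refl (a ∙ v) slack y) (trans (*-congˡ gy≈1) (*-identityʳ slack)))
        (*-monoˡ-≤ (<⇒≤ 0<g) δ≤)))
    where
    moved : ∀ δ → δ * a ∙ v ≤ b - a ∙ x → Sat (λ i → 1# * x i + δ * v i) (a , b)
    moved δ p = from-diff (x≤y⇒0≤y-x p) (trans (+-congˡ (-‿cong (trans (∙-linearʳ 1# δ a x v) (+-congʳ (*-identityˡ _)))))
      (solve 3 (λ b x g → b :- (x :+ g) := (b :- x) :- g) refl b (a ∙ x) (δ * a ∙ v)))

  module _ {d : ℕ} (a : Vec d) (b : F) (cs : List (Constraint d)) where

    -- The segment from the interior point `z` to `y` crosses the hyperplane. The crossing point
    -- gives `z` a positive weight, so it inherits strictness in the other constraints.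
    boundary-point : ∀ {z y} → Strict z (a , b) → All (Strict z) cs → ¬ Sat y (a , b) → All (Sat y) cs →
      ¬ ¬ (∃[ x ] (a ∙ x ≈ b × All (Strict x) cs))
    boundary-point {z} {y} z-strict z-stricts y-unsat y-sats = do
      (h , 0<h , gap*h≈1) ← inverse-pos {a ∙ y - a ∙ z} (λ gap≤0 → y-unsat (≤-trans (x-y≤0⇒x≤y gap≤0) (<⇒≤ z-strict)))
      let s = (a ∙ y - b) * h
          t = (b - a ∙ z) * h
          s+t≈1 : s + t ≈ 1#
          s+t≈1 = trans (solve 4 (λ y z b h → (y :- b) :* h :+ (b :- z) :* h := (y :- z) :* h) refl (a ∙ y) (a ∙ z) b h) gap*h≈1
          0<s : 0# < s
          0<s = *-pos (λ p → y-unsat (x-y≤0⇒x≤y p)) 0<h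
          0<t : 0# < t
          0<t = *-pos (λ p → z-strict (x-y≤0⇒x≤y p)) 0<h
      return ((λ i → s * z i + t * y i) ,
        (begin
          a ∙ (λ i → s * z i + t * y i)     ≈⟨ ∙-linearʳ s t a z y ⟩
          s * a ∙ z + t * a ∙ y
            ≈⟨ solve 4 (λ y z b h → (y :- b) :* h :* z :+ (b :- z) :* h :* y := b :* ((y :- z) :* h)) refl (a ∙ y) (a ∙ z) b h ⟩
          b * ((a ∙ y - a ∙ z) * h)         ≈⟨ trans (*-congˡ gap*h≈1) (*-identityʳ b) ⟩
          b                                 ∎) ,
        All.zipWith (λ { {e , _} (p , q) → convex-strict s+t≈1 e z y 0<s (<⇒≤ 0<t) p q }) (z-stricts , y-sats))

    record FacetPoints : Set where
      field
        point       : Fin d → Vec d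
        independent : AffinelyIndependent point
        on          : ∀ j → a ∙ point j ≈ b
        sat         : ∀ j → All (Sat (point j)) cs
        parallel    : ∀ ℓ → NonZeroVector ℓ → (∀ j l → ℓ ∙ (λ i → point j i - point l i) ≈ 0#) →
                      ¬ ¬ (∃[ s ] (∀ i → a i ≈ s * ℓ i))

    -- From a point x of the facet that satisfies the other constraints strictly, move a little
    -- along the vectors aᵢ eⱼ − aⱼ eᵢ, which span the direction of the hyperplane.
    facet-points : ∀ {x} → a ∙ x ≈ b → All (Strict x) cs → NonZeroVector a → ¬ ¬ FacetPoints
    facet-points {x} a∙x≈b strict a≉0 = do
      (i , aᵢ≉0) ← nonzero-coordinate a a≉0
      let v : Fin d → Vec d
          v j l = a i * single j 1# l + - a j * single i 1# l
      (ε , 0<ε , small) ← small-∀ λ j → small-All (All.map (small-move x (v j)) strict)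
      return (assemble i aᵢ≉0 ε 0<ε (small ε (<⇒≤ 0<ε) ≤-refl))
      where
      assemble : ∀ i → a i ≉ 0# → ∀ ε → 0# < ε →
        (∀ j → All (Sat (λ l → 1# * x l + ε * (a i * single j 1# l + - a j * single i 1# l))) cs) → FacetPoints
      assemble i aᵢ≉0 ε 0<ε sat = record
        { point = point
        ; independent = independent
        ; on = λ j → trans (∙-linearʳ 1# ε a x (v j))
            (trans (+-cong (trans (*-identityˡ _) a∙x≈b) (trans (*-congˡ (trans (∙-v a j) (a-flat j))) (zeroʳ ε))) (+-identityʳ b))
        ; sat = sat
        ; parallel = parallel
        }
        where
        v : Fin d → Vec d
        v j l = a i * single j 1# l + - a j * single i 1# l
        point : Fin d → Vec d
        point j l = 1# * x l + ε * v j l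
        ε*-cancel : ∀ {y} → ε * y ≈ 0# → y ≈ 0#
        ε*-cancel εy≈0 = ≈-stable λ y≉0 → *-nonZero (λ ε≈0 → <⇒≉ 0<ε (sym ε≈0)) y≉0 εy≈0
        ∙-v : ∀ ℓ j → ℓ ∙ v j ≈ a i * ℓ j - a j * ℓ i
        ∙-v ℓ j = trans (∙-linearʳ (a i) (- a j) ℓ (single j 1#) (single i 1#))
          (+-cong (*-congˡ (∙-single j)) (trans (*-congˡ (∙-single i)) (solve 2 (λ a ℓ → (:- a) :* ℓ := :- (a :* ℓ)) refl (a j) (ℓ i))))
          where
          ∙-single : ∀ j → ℓ ∙ single j 1# ≈ ℓ j
          ∙-single j = trans (∙-comm ℓ (single j 1#)) (trans (single-∙ j 1# ℓ) (*-identityˡ (ℓ j)))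
        a-flat : ∀ j → a i * a j - a j * a i ≈ 0#
        a-flat j = trans (+-congˡ (-‿cong (*-comm (a j) (a i)))) (-‿inverseʳ _)
        independent : AffinelyIndependent point
        -- For `l ≢ i`, only `v l` has a nonzero coordinate `l`, equal to `a i`, so `c l` vanishes.
        -- As `v i` is zero, coordinates say nothing about `c i`, which is instead obtained from the
        -- vanishing of `sum c`.
        independent c sum-c dep = by-cases i (trans (sym (sum-single c i off-i)) sum-c) off-i
          where
          off-i : ∀ l → l ≢ i → c l ≈ 0#
          off-i l l≢i = ≈-stable λ cₗ≉0 → *-nonZero cₗ≉0 aᵢ≉0 (ε*-cancel (begin
            ε * (c l * a i)
              ≈⟨ *-congˡ (*-congˡ (sym (trans (+-cong (trans (*-congˡ (single-at l 1#)) (*-identityʳ (a i)))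
                   (trans (*-congˡ (single-off i 1# l l≢i)) (zeroʳ _))) (+-identityʳ (a i))))) ⟩
            ε * (c l * v l l)
              ≈⟨ *-congˡ (sum-single (λ j → c j * v j l) l λ j j≢l → trans (*-congˡ
                   (trans (+-cong (trans (*-congˡ (single-off j 1# l (j≢l ∘ ≡.sym))) (zeroʳ _))
                     (trans (*-congˡ (single-off i 1# l l≢i)) (zeroʳ _))) (+-identityʳ 0#))) (zeroʳ (c j))) ⟨
            ε * sum (λ j → c j * v j l)
              ≈⟨ trans (+-congʳ (trans (*-congˡ sum-c) (zeroʳ (x l)))) (+-identityˡ _) ⟨
            x l * sum c + ε * sum (λ j → c j * v j l)
              ≈⟨ sum-linear (x l) ε c (λ j → c j * v j l) ⟨
            sum (λ j → x l * c j + ε * (c j * v j l))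
              ≈⟨ sum-cong {d} (λ j → trans (solve 4 (λ x c ε v → x :* c :+ ε :* (c :* v) := c :* (x :+ ε :* v)) refl (x l) (c j) ε (v j l))
                   (*-congˡ (+-congʳ (sym (*-identityˡ (x l)))))) ⟩
            sum (λ j → c j * point j l)
              ≈⟨ dep l ⟩
            0# ∎))
        parallel : ∀ ℓ → NonZeroVector ℓ → (∀ j l → ℓ ∙ (λ i → point j i - point l i) ≈ 0#) →
          ¬ ¬ (∃[ s ] (∀ i → a i ≈ s * ℓ i))
        parallel ℓ ℓ≉0 orth = do
          (y , ℓᵢy≈1) ← inverse ℓᵢ≉0
          return (a i * y , λ j → begin
            a j                  ≈⟨ trans (*-congˡ ℓᵢy≈1) (*-identityʳ (a j)) ⟨
            a j * (ℓ i * y)      ≈⟨ *-assoc (a j) (ℓ i) y ⟨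
            a j * ℓ i * y        ≈⟨ *-congʳ (cross j) ⟨
            a i * ℓ j * y        ≈⟨ solve 3 (λ a ℓ y → a :* ℓ :* y := a :* y :* ℓ) refl (a i) (ℓ j) y ⟩
            a i * y * ℓ j        ∎)
          where
          cross : ∀ j → a i * ℓ j ≈ a j * ℓ i
          -- The difference of the points `j` and `i` is `ε` times `v j - v i`, and `ℓ ∙ v j` is the
          -- minor `a i * ℓ j - a j * ℓ i`, which is zero for `j = i`.
          cross j = x-y≈0⇒x≈y (ε*-cancel (begin
            ε * (a i * ℓ j - a j * ℓ i)
              ≈⟨ trans (+-congˡ (trans (*-congˡ (-‿inverseʳ _)) (zeroʳ (- ε)))) (+-identityʳ _) ⟨
            ε * (a i * ℓ j - a j * ℓ i) + - ε * (a i * ℓ i - a i * ℓ i)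
              ≈⟨ +-cong (*-congˡ (∙-v ℓ j)) (*-congˡ (∙-v ℓ i)) ⟨
            ε * ℓ ∙ v j + - ε * ℓ ∙ v i
              ≈⟨ ∙-linearʳ ε (- ε) ℓ (v j) (v i) ⟨
            ℓ ∙ (λ l → ε * v j l + - ε * v i l)
              ≈⟨ ∙-cong {a = ℓ} (λ _ → refl) (λ l → solve 4 (λ x ε v w → ε :* v :+ (:- ε) :* w := (x :+ ε :* v) :- (x :+ ε :* w))
                   refl (1# * x l) ε (v j l) (v i l)) ⟩
            ℓ ∙ (λ l → point j l - point i l)
              ≈⟨ orth j i ⟩
            0# ∎))
          ℓᵢ≉0 : ℓ i ≉ 0#
          ℓᵢ≉0 ℓᵢ≈0 = ℓ≉0 λ j → ≈-stable λ ℓⱼ≉0 → *-nonZero aᵢ≉0 ℓⱼ≉0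
            (trans (cross j) (trans (*-congˡ ℓᵢ≈0) (zeroʳ (a j))))

  module _ {d k : ℕ} (normal : Fin k → Vec d) (normal≉0 : ∀ i → NonZeroVector (normal i)) where

    Parallel : Constraint d → Set
    Parallel (a , _) = ∃[ i ] ∃[ s ] (∀ j → a j ≈ s * normal i j)

    record Represents (P : Vec d → Set) (cs : List (Constraint d)) : Set where
      constructor represents
      field
        sound    : ∀ {x} → P x → All (Sat x) cs
        complete : ∀ {x} → All (Sat x) cs → P x

    -- Redundant constraints are discarded one at a time; each constraint that is kept
    -- is irredundant when it is examined, and so defines a facet.
    parallel-representation : ∀ {P} →
      (∀ a b (p : Fin d → Vec d) → NonZeroVector a → (∀ {x} → P x → a ∙ x ≤ b) → AffinelyIndependent p →
        (∀ j → P (p j)) → (∀ j → a ∙ p j ≈ b) →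
        ¬ ¬ (∃[ i ] (∀ j l → normal i ∙ (λ r → p j r - p l r) ≈ 0#))) →
      ∀ {z} kept pending → Represents P (kept ++ pending) → All (Strict z) (kept ++ pending) →
      All Parallel kept → All (NonZeroVector ∘ proj₁) pending →
      ¬ ¬ (∃[ cs ] (Represents P cs × All Parallel cs))
    parallel-representation facets kept [] rep strict par nonzero = return (kept ++ [] , rep , All.++⁺ par [])
    parallel-representation facets {z} kept ((a , b) ∷ cs) (represents sound complete) strict par (a≉0 ∷ nonzero) = do
      yes (y , y-sat , y-unsat) ← em {A = ∃[ y ] (All (Sat y) (kept ++ cs) × ¬ Sat y (a , b))}
        where no redundant → parallel-representation facets {z} kept cs
                (represents (λ x∈P → weaken (sound x∈P))
                  (λ {x} sat → complete (insert kept (≤-stable λ ¬s → redundant (x , sat , ¬s)) sat)))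
                (weaken strict) par nonzero
      (x , on , x-strict) ← boundary-point a b (kept ++ cs) (All.head (All.++⁻ʳ kept strict)) (weaken strict) y-unsat y-sat
      pts ← facet-points a b (kept ++ cs) on x-strict a≉0
      let open FacetPoints pts
      (i , orth) ← facets a b point a≉0 (λ x∈P → All.head (All.++⁻ʳ kept (sound x∈P))) independent
        (λ j → complete (insert kept (≤-reflexive (FacetPoints.on pts j)) (sat j))) (FacetPoints.on pts)
      (s , a≈) ← parallel (normal i) (normal≉0 i) orth
      parallel-representation facets {z} ((a , b) ∷ kept) cs
        (represents (λ x∈P → front (sound x∈P)) (λ { (s ∷ ss) → complete (insert kept s ss) }))
        (front strict) ((i , s , a≈) ∷ par) nonzero
      where
      module _ {Q : Constraint d → Set} where
        weaken : All Q (kept ++ (a , b) ∷ cs) → All Q (kept ++ cs)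
        weaken qs = All.++⁺ (All.++⁻ˡ kept qs) (All.tail (All.++⁻ʳ kept qs))
        front : All Q (kept ++ (a , b) ∷ cs) → All Q (((a , b) ∷ kept) ++ cs)
        front qs = All.head (All.++⁻ʳ kept qs) ∷ weaken qs
        insert : ∀ kept → Q (a , b) → All Q (kept ++ cs) → All Q (kept ++ (a , b) ∷ cs)
        insert kept q qs = All.++⁺ (All.++⁻ˡ kept qs) (q ∷ All.++⁻ʳ kept qs)

  -- From disjoint polytopes to the bound on cliques

  module IntersectionGraphs {d k : ℕ} (normal : Fin k → Vec d) (normal≉0 : ∀ i → NonZeroVector (normal i)) where
    open Directions normal

    Representable : (Vec d → Set) → Set
    Representable P = ¬ ¬ (∃[ cs ] (Represents normal normal≉0 P cs × All (Parallel normal normal≉0) cs))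

    module _ {P Q : Vec d → Set} (P≢∅ : ∃ P) (Q≢∅ : ∃ Q) where

      private
        X : Fin k ⊎ Fin k → Vec d → Set
        X = [ (λ _ → P) , (λ _ → Q) ]′

        nonempty : ∀ e → ∃ (X e)
        nonempty (inj₁ _) = P≢∅
        nonempty (inj₂ _) = Q≢∅

        derivable : ∀ {a b e} j → splitAt k j ≡ e → ∀ s → (∀ r → a r ≈ s * w e r) → (∀ x → X e x → a ∙ x ≤ b) →
          Derivable w X (splitAt k) a b
        derivable j ≡.refl = derivable-constraint w X (splitAt k) j

      separating-line : Representable P → Representable Q → ¬ P ≬ Q →
        ¬ ¬ (∃[ e ] ∃[ u ] (Line (decode {k} {d} e) u × Separates u P Q))
      separating-line P-rep Q-rep disjoint = do
        (cs , represents P-sound P-complete , P-parallel) ← P-rep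
        (cs′ , represents Q-sound Q-complete , Q-parallel) ← Q-rep
        -- The `k + k` indices list every normal once for each polytope, so each constraint is a
        -- multiple of a single listed vector.
        cert₀ ← infeasible-certificate w X (splitAt k) (λ j → nonempty (splitAt k j)) (cs ++ cs′)
          (All.++⁺
            (All.tabulate λ c∈ → let i , s , a≈ = All.lookup P-parallel c∈ in
              derivable (i ↑ˡ k) (Fin.splitAt-↑ˡ k i k) s a≈ λ x x∈P → All.lookup (P-sound x∈P) c∈)
            (All.tabulate λ c∈ → let i , s , a≈ = All.lookup Q-parallel c∈ in
              derivable (k ↑ʳ i) (Fin.splitAt-↑ʳ k k i) s a≈ λ x x∈Q → All.lookup (Q-sound x∈Q) c∈))
          λ (x , sat) → disjoint (x , P-complete (All.++⁻ˡ cs sat) , Q-complete (All.++⁻ʳ cs sat))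
        (m , T , cert , circuit) ← circuit-certificate w X cert₀
        (e , T⊆ , ⊆T) ← return (decode-surjective {d} T
          (≡.subst (m ℕ.≤_) (ℕ.+-comm 1 d) (circuit-size w X {T = T} circuit))
          (certificate-left P≢∅ Q≢∅ cert circuit) (certificate-right P≢∅ Q≢∅ cert circuit))
        return (e , _ , line-reindex {T = T} {decode {k} {d} e} T⊆ ⊆T (certificate-line P≢∅ Q≢∅ cert circuit) ,
          certificate-separates P≢∅ Q≢∅ cert circuit)

    maximalCliques-bound : ∀ {n} (G : Graph (suc n)) (R : Fin (suc n) → Vec d → Set) →
      (∀ v → ∃ (R v)) → (∀ v → Representable (R v)) →
      (∀ {u v} → u ≢ v → Graph._~_ G u v ⇔ R u ≬ R v) →
      ∀ Cs → Unique Cs → All (IsMaximalClique G) Cs → length Cs ℕ.≤ suc n ℕ.^ (d ℕ.* k ℕ.^ (d ℕ.+ 1))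
    maximalCliques-bound G R nonempty representable intersection Cs unique maximal =
      decidable-stable (length Cs ℕ.≤? _) (do
        directions ← ¬¬∀ λ e → direction (decode {k} {d} e)
        comparable ← ¬¬∀ λ u → ¬¬∀ λ v → comparable directions u v
        return (MaximalCliques.maximalCliques-bound G
          (λ u e v → Separates (proj₁ (directions e)) (R u) (R v))
          (λ {e} → separates-interval-order {u = proj₁ (directions e)})
          (λ {e} {u} sep → let x , x∈ = nonempty u in
            separates-disjoint {u = proj₁ (directions e)} {R u} {R u} sep x∈ x∈)
          (λ {e} {u} {v} u~v sep →
            let x , x∈u , x∈v = Equivalence.to (intersection λ u≡v → Graph.irrefl G u≡v u~v) u~v in
            separates-disjoint {u = proj₁ (directions e)} {R u} {R v} sep x∈u x∈v)
          comparable zero Cs unique maximal))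
      where
      comparable : (directions : ∀ e → ∃[ u₀ ] (∀ u → Line (decode {k} {d} e) u →
          ¬ ¬ (∃[ t ] (t ≉ 0# × (∀ i → u₀ i ≈ t * u i))))) → ∀ u v → ¬ ¬ (u ≢ v → Graph._~_ G u v ⊎
          ∃[ e ] (Separates (proj₁ (directions e)) (R u) (R v) ⊎ Separates (proj₁ (directions e)) (R v) (R u)))
      comparable directions u v = do
        no disjoint ← em {A = R u ≬ R v}
          where yes common → return λ u≢v → inj₁ (Equivalence.from (intersection u≢v) common)
        (e , x , line , sep) ← separating-line (nonempty u) (nonempty v) (representable u) (representable v) disjoint
        (t , t≉0 , u₀≈tx) ← proj₂ (directions e) x line
        -- The direction found for this pair is proportional to the one fixed in advance, but the
        -- factor may be negative; this may exchange the two polytopes.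
        sep′ ← separates-scale t≉0 u₀≈tx sep
        return λ _ → inj₂ (e , sep′)

-- The ordered field of real numbers

module Reals where
  open Defs

  _∧_ : ∀ {P Q} → Eventually P → Eventually Q → Eventually λ n → P n × Q n
  (M , p) ∧ (N , q) = M ℕ.⊔ N , λ n ≤n → p n (ℕ.m⊔n≤o⇒m≤o M N ≤n) , q n (ℕ.m⊔n≤o⇒n≤o M N ≤n)

  eventually-map : ∀ {P Q} → (∀ n → P n → Q n) → Eventually P → Eventually Q
  eventually-map f (N , p) = N , λ n N≤n → f n (p n N≤n)

  eventually-witness : ∀ {P} → Eventually P → ∃ P
  eventually-witness (N , p) = N , p N ℕ.≤-refl

  module _ where
    open ℚ.+-*-Solver

    p≤∣p∣ : ∀ p → p ℚ.≤ ∣ p ∣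
    p≤∣p∣ p with ℚ.≤-total 0ℚ p
    ... | inj₁ 0≤p = ℚ.≤-reflexive (≡.sym (ℚ.0≤p⇒∣p∣≡p 0≤p))
    ... | inj₂ p≤0 = ℚ.≤-trans p≤0 (ℚ.0≤∣p∣ p)

    ∣p-q∣<ε⇒p≤q+ε : ∀ {p q ε} → ∣ p ℚ.- q ∣ ℚ.< ε → p ℚ.≤ q ℚ.+ ε
    ∣p-q∣<ε⇒p≤q+ε {p} {q} {ε} h = begin
      p                       ≡⟨ solve 2 (λ p q → p := q :+ (p :- q)) ≡.refl p q ⟩
      q ℚ.+ (p ℚ.- q)         ≤⟨ ℚ.+-monoʳ-≤ q (p≤∣p∣ (p ℚ.- q)) ⟩
      q ℚ.+ ∣ p ℚ.- q ∣       <⟨ ℚ.+-monoʳ-< q h ⟩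
      q ℚ.+ ε                 ∎
      where open ℚ.≤-Reasoning

    p≤q+ε∧q≤p+ε⇒∣p-q∣≤ε : ∀ {p q ε} → p ℚ.≤ q ℚ.+ ε → q ℚ.≤ p ℚ.+ ε → ∣ p ℚ.- q ∣ ℚ.≤ ε
    p≤q+ε∧q≤p+ε⇒∣p-q∣≤ε {p} {q} {ε} h k with ℚ.∣p∣≡p∨∣p∣≡-p (p ℚ.- q)
    ... | inj₁ eq = begin
      ∣ p ℚ.- q ∣           ≡⟨ eq ⟩
      p ℚ.- q               ≤⟨ ℚ.+-monoˡ-≤ (ℚ.- q) h ⟩
      q ℚ.+ ε ℚ.- q         ≡⟨ solve 2 (λ q ε → q :+ ε :- q := ε) ≡.refl q ε ⟩
      ε                     ∎
      where open ℚ.≤-Reasoning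
    ... | inj₂ eq = begin
      ∣ p ℚ.- q ∣           ≡⟨ eq ⟩
      ℚ.- (p ℚ.- q)         ≡⟨ solve 2 (λ p q → :- (p :- q) := q :- p) ≡.refl p q ⟩
      q ℚ.- p               ≤⟨ ℚ.+-monoˡ-≤ (ℚ.- p) k ⟩
      p ℚ.+ ε ℚ.- p         ≡⟨ solve 2 (λ q ε → q :+ ε :- q := ε) ≡.refl p ε ⟩
      ε                     ∎
      where open ℚ.≤-Reasoning

  pointwise : ∀ {x y} → (∀ n → seq x n ≡ seq y n) → x ≈ y
  pointwise {x} {y} eq = mk≈ λ ε 0<ε → 0 , λ n _ → ≡.subst (ℚ._< ε)
    (≡.cong ∣_∣ (≡.sym (≡.trans (≡.cong (ℚ._- seq y n) (eq n)) (ℚ.+-inverseʳ (seq y n))))) 0<ε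

  ½ε<ε : ∀ {ε} → 0ℚ ℚ.< ε → ½ ℚ.* ε ℚ.< ε
  ½ε<ε {ε} 0<ε = begin-strict
    ½ ℚ.* ε                   ≡⟨ ℚ.+-identityʳ _ ⟨
    ½ ℚ.* ε ℚ.+ 0ℚ            <⟨ ℚ.+-monoʳ-< (½ ℚ.* ε) (½*-pos 0<ε) ⟩
    ½ ℚ.* ε ℚ.+ ½ ℚ.* ε       ≡⟨ ½+½ ε ⟩
    ε                         ∎
    where open ℚ.≤-Reasoning

  ≈⇒≤ : ∀ {x y} → x ≈ y → x ≤ y
  ≈⇒≤ x≈y = mk≤ λ ε 0<ε → eventually-map (λ n → ∣p-q∣<ε⇒p≤q+ε) (close x≈y ε 0<ε)

  ≤-antisym : ∀ {x y} → x ≤ y → y ≤ x → x ≈ y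
  ≤-antisym x≤y y≤x = mk≈ λ ε 0<ε →
    eventually-map (λ n (p , q) → ℚ.≤-<-trans (p≤q+ε∧q≤p+ε⇒∣p-q∣≤ε p q) (½ε<ε 0<ε))
      (below x≤y (½ ℚ.* ε) (½*-pos 0<ε) ∧ below y≤x (½ ℚ.* ε) (½*-pos 0<ε))

  ≤-trans : ∀ {x y z} → x ≤ y → y ≤ z → x ≤ z
  ≤-trans {x} {y} {z} x≤y y≤z = mk≤ λ ε 0<ε →
    eventually-map (λ n (p , q) → begin
        seq x n                               ≤⟨ p ⟩
        seq y n ℚ.+ ½ ℚ.* ε                   ≤⟨ ℚ.+-monoˡ-≤ (½ ℚ.* ε) q ⟩
        seq z n ℚ.+ ½ ℚ.* ε ℚ.+ ½ ℚ.* ε       ≡⟨ ℚ.+-assoc (seq z n) _ _ ⟩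
        seq z n ℚ.+ (½ ℚ.* ε ℚ.+ ½ ℚ.* ε)     ≡⟨ ≡.cong (seq z n ℚ.+_) (½+½ ε) ⟩
        seq z n ℚ.+ ε                         ∎)
      (below x≤y (½ ℚ.* ε) (½*-pos 0<ε) ∧ below y≤z (½ ℚ.* ε) (½*-pos 0<ε))
    where open ℚ.≤-Reasoning

  ≈-refl : ∀ {x} → x ≈ x
  ≈-refl = pointwise λ _ → ≡.refl

  ≈-sym : ∀ {x y} → x ≈ y → y ≈ x
  ≈-sym {x} {y} x≈y = mk≈ λ ε 0<ε → eventually-map
    (λ n → ≡.subst (ℚ._< ε) (≡.trans (≡.sym (ℚ.∣-p∣≡∣p∣ (seq x n ℚ.- seq y n)))
      (≡.cong ∣_∣ (solve 2 (λ p q → :- (p :- q) := q :- p) ≡.refl (seq x n) (seq y n)))))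
    (close x≈y ε 0<ε)
    where open ℚ.+-*-Solver

  ≈-trans : ∀ {x y z} → x ≈ y → y ≈ z → x ≈ z
  ≈-trans p q = ≤-antisym (≤-trans (≈⇒≤ p) (≈⇒≤ q)) (≤-trans (≈⇒≤ (≈-sym q)) (≈⇒≤ (≈-sym p)))

  +-monoʳ-≤ : ∀ z {x y} → x ≤ y → z + x ≤ z + y
  +-monoʳ-≤ z {x} {y} x≤y = mk≤ λ ε 0<ε → eventually-map
    (λ n p → ℚ.≤-trans (ℚ.+-monoʳ-≤ (seq z n) p) (ℚ.≤-reflexive (≡.sym (ℚ.+-assoc (seq z n) (seq y n) ε))))
    (below x≤y ε 0<ε)

  +-congˡ : ∀ {x y} z → x ≈ y → z + x ≈ z + y
  +-congˡ z x≈y = ≤-antisym (+-monoʳ-≤ z (≈⇒≤ x≈y)) (+-monoʳ-≤ z (≈⇒≤ (≈-sym x≈y)))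

  +-comm : ∀ x y → x + y ≈ y + x
  +-comm x y = pointwise λ n → ℚ.+-comm (seq x n) (seq y n)

  +-cong : ∀ {x y u v} → x ≈ y → u ≈ v → x + u ≈ y + v
  +-cong {x} {y} {u} {v} p q = ≈-trans (+-congˡ x q) (≈-trans (+-comm x v) (≈-trans (+-congˡ v p) (+-comm v y)))

  -‿cong : ∀ {x y} → x ≈ y → - x ≈ - y
  -‿cong {x} {y} x≈y = mk≈ λ ε 0<ε → eventually-map
    (λ n → ≡.subst (ℚ._< ε) (≡.trans (≡.sym (ℚ.∣-p∣≡∣p∣ (seq x n ℚ.- seq y n)))
      (≡.cong ∣_∣ (solve 2 (λ p q → :- (p :- q) := :- p :- (:- q)) ≡.refl (seq x n) (seq y n)))))
    (close x≈y ε 0<ε)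
    where open ℚ.+-*-Solver

  *-comm : ∀ x y → x * y ≈ y * x
  *-comm x y = pointwise λ n → ℚ.*-comm (seq x n) (seq y n)

  *-congˡ : ∀ {x y} z → x ≈ y → z * x ≈ z * y
  *-congˡ {x} {y} z x≈y = mk≈ λ ε 0<ε →
    let K , 0<K , z<K = bounded (seq z) (cauchy z)
        δ , 0<δ , Kδ≡ε = shrink 0<K 0<ε
    in eventually-map
         (λ n (∣z∣<K , x-y<δ) → ≡.subst₂ ℚ._<_
           (≡.cong ∣_∣ (solve 3 (λ z x y → z :* (x :- y) := z :* x :- z :* y) ≡.refl (seq z n) (seq x n) (seq y n)))
           Kδ≡ε (∣pq∣<Kδ 0<K ∣z∣<K x-y<δ))
         (z<K ∧ close x≈y δ 0<δ)
    where open ℚ.+-*-Solver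

  *-cong : ∀ {x y u v} → x ≈ y → u ≈ v → x * u ≈ y * v
  *-cong {x} {y} {u} {v} p q = ≈-trans (*-congˡ x q) (≈-trans (*-comm x v) (≈-trans (*-congˡ v p) (*-comm v y)))

  1ℝ : ℝ
  1ℝ = mkℝ (λ _ → 1ℚ) (const-cauchy 1ℚ)

  ℝ-isCommutativeRing : IsCommutativeRing _≈_ _+_ _*_ -_ 0ℝ 1ℝ
  ℝ-isCommutativeRing = record
    { isRing = record
      { +-isAbelianGroup = record
        { isGroup = record
          { isMonoid = record
            { isSemigroup = record
              { isMagma = record
                { isEquivalence = record { refl = ≈-refl ; sym = ≈-sym ; trans = ≈-trans }
                ; ∙-cong = +-cong }
              ; assoc = λ x y z → pointwise λ n → ℚ.+-assoc (seq x n) (seq y n) (seq z n) }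
            ; identity = (λ x → pointwise λ n → ℚ.+-identityˡ (seq x n)) , (λ x → pointwise λ n → ℚ.+-identityʳ (seq x n)) }
          ; inverse = (λ x → pointwise λ n → ℚ.+-inverseˡ (seq x n)) , (λ x → pointwise λ n → ℚ.+-inverseʳ (seq x n))
          ; ⁻¹-cong = -‿cong }
        ; comm = +-comm }
      ; *-cong = *-cong
      ; *-assoc = λ x y z → pointwise λ n → ℚ.*-assoc (seq x n) (seq y n) (seq z n)
      ; *-identity = (λ x → pointwise λ n → ℚ.*-identityˡ (seq x n)) , (λ x → pointwise λ n → ℚ.*-identityʳ (seq x n))
      ; distrib = (λ x y z → pointwise λ n → ℚ.*-distribˡ-+ (seq x n) (seq y n) (seq z n)) ,
                  (λ x y z → pointwise λ n → ℚ.*-distribʳ-+ (seq x n) (seq y n) (seq z n)) }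
    ; *-comm = *-comm }

  -- A constructive substitute for deciding the order: the alternatives overlap, and the tolerance
  -- `ε` is what makes the choice computable.
  data Comparison (x y : ℝ) (ε : ℚ) : Set where
    ≲ : Eventually (λ n → seq x n ℚ.≤ seq y n ℚ.+ ε) → Comparison x y ε
    ≫ : ∀ δ → 0ℚ ℚ.< δ → Eventually (λ n → seq y n ℚ.+ δ ℚ.≤ seq x n) → Comparison x y ε

  -- Compare the two sequences at a sufficiently late index.
  compare : ∀ x y ε → 0ℚ ℚ.< ε → Comparison x y ε
  -- Beyond `N` the difference varies by less than a quarter of `ε`. Testing it against a half
  -- leaves it below `ε` in one case and above a quarter of `ε` in the other.
  compare x y ε 0<ε = decide (seq x N ℚ.- seq y N ℚ.≤? ½ ℚ.* ε)
    where
    open ℚ.≤-Reasoning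
    open ℚ.+-*-Solver
    0<½½ε : 0ℚ ℚ.< ½ ℚ.* ½ ℚ.* ε
    0<½½ε = ≡.subst (0ℚ ℚ.<_) (≡.sym (ℚ.*-assoc ½ ½ ε)) (½*-pos (½*-pos 0<ε))
    z : ℝ
    z = x - y
    N = proj₁ (cauchy z (½ ℚ.* ½ ℚ.* ε) 0<½½ε)
    near : ∀ n → N ℕ.≤ n → ∣ seq z n ℚ.- seq z N ∣ ℚ.< ½ ℚ.* ½ ℚ.* ε
    near n N≤n = proj₂ (cauchy z (½ ℚ.* ½ ℚ.* ε) 0<½½ε) n N N≤n ℕ.≤-refl
    near′ : ∀ n → N ℕ.≤ n → ∣ seq z N ℚ.- seq z n ∣ ℚ.< ½ ℚ.* ½ ℚ.* ε
    near′ n N≤n = proj₂ (cauchy z (½ ℚ.* ½ ℚ.* ε) 0<½½ε) N n ℕ.≤-refl N≤n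
    decide : Dec (seq z N ℚ.≤ ½ ℚ.* ε) → Comparison x y ε
    decide (yes small) = ≲ (N , λ n N≤n → begin
      seq x n                                        ≡⟨ solve 2 (λ x y → x := y :+ (x :- y)) ≡.refl (seq x n) (seq y n) ⟩
      seq y n ℚ.+ seq z n                            ≤⟨ ℚ.+-monoʳ-≤ (seq y n) (∣p-q∣<ε⇒p≤q+ε (near n N≤n)) ⟩
      seq y n ℚ.+ (seq z N ℚ.+ ½ ℚ.* ½ ℚ.* ε)        ≤⟨ ℚ.+-monoʳ-≤ (seq y n) (ℚ.+-mono-≤ small
        (ℚ.≤-trans (ℚ.≤-reflexive (ℚ.*-assoc ½ ½ ε)) (ℚ.<⇒≤ (½ε<ε (½*-pos 0<ε))))) ⟩
      seq y n ℚ.+ (½ ℚ.* ε ℚ.+ ½ ℚ.* ε)              ≡⟨ ≡.cong (seq y n ℚ.+_) (½+½ ε) ⟩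
      seq y n ℚ.+ ε                                  ∎)
    decide (no large) = ≫ (½ ℚ.* ½ ℚ.* ε) 0<½½ε (N , λ n N≤n → begin
      seq y n ℚ.+ ½ ℚ.* ½ ℚ.* ε
        ≡⟨ solve 2 (λ y ε → y :+ con ½ :* con ½ :* ε := y :+ (con ½ :* ε :- con ½ :* con ½ :* ε)) ≡.refl (seq y n) ε ⟩
      seq y n ℚ.+ (½ ℚ.* ε ℚ.- ½ ℚ.* ½ ℚ.* ε)
        ≤⟨ ℚ.+-monoʳ-≤ (seq y n) (ℚ.+-monoˡ-≤ (ℚ.- (½ ℚ.* ½ ℚ.* ε)) (ℚ.<⇒≤ (ℚ.≰⇒> large))) ⟩
      seq y n ℚ.+ (seq z N ℚ.- ½ ℚ.* ½ ℚ.* ε)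
        ≤⟨ ℚ.+-monoʳ-≤ (seq y n) (ℚ.+-monoˡ-≤ (ℚ.- (½ ℚ.* ½ ℚ.* ε)) (∣p-q∣<ε⇒p≤q+ε {seq z N} {seq z n} (near′ n N≤n))) ⟩
      seq y n ℚ.+ (seq z n ℚ.+ ½ ℚ.* ½ ℚ.* ε ℚ.- ½ ℚ.* ½ ℚ.* ε)
        ≡⟨ solve 3 (λ x y ε → y :+ (x :- y :+ ε :- ε) := x) ≡.refl (seq x n) (seq y n) (½ ℚ.* ½ ℚ.* ε) ⟩
      seq x n ∎)

  ≫⇒≰ : ∀ {x y δ} → 0ℚ ℚ.< δ → Eventually (λ n → seq y n ℚ.+ δ ℚ.≤ seq x n) → ¬ x ≤ y
  ≫⇒≰ {x} {y} {δ} 0<δ x≫y x≤y =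
    let n , p , q = eventually-witness (x≫y ∧ below x≤y (½ ℚ.* δ) (½*-pos 0<δ))
    in ℚ.<-irrefl ≡.refl (ℚ.<-≤-trans (ℚ.+-monoʳ-< (seq y n) (½ε<ε 0<δ)) (ℚ.≤-trans p q))

  -- For each tolerance, the second alternative of the comparison refutes `x ≤ y`, so the doubly
  -- negated hypothesis leaves only the first.
  ≤-stable : ∀ {x y} → ¬ ¬ x ≤ y → x ≤ y
  ≤-stable {x} {y} ¬¬x≤y = mk≤ λ ε 0<ε → case ε (compare x y ε 0<ε)
    where
    case : ∀ ε → Comparison x y ε → Eventually λ n → seq x n ℚ.≤ seq y n ℚ.+ ε
    case ε (≲ p)       = p
    case ε (≫ δ 0<δ p) = contradiction (≫⇒≰ {x} {y} 0<δ p) ¬¬x≤y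

  ≰⇒≥ : ∀ {x y} → ¬ x ≤ y → y ≤ x
  ≰⇒≥ {x} {y} x≰y = mk≤ λ ε 0<ε → case ε (compare y x ε 0<ε)
    where
    case : ∀ ε → Comparison y x ε → Eventually λ n → seq y n ℚ.≤ seq x n ℚ.+ ε
    case ε (≲ p)       = p
    case ε (≫ δ 0<δ p) = contradiction
      (mk≤ λ η 0<η → eventually-map (λ n p → begin
        seq x n                ≡⟨ ℚ.+-identityʳ _ ⟨
        seq x n ℚ.+ 0ℚ         ≤⟨ ℚ.+-monoʳ-≤ (seq x n) (ℚ.<⇒≤ 0<δ) ⟩
        seq x n ℚ.+ δ          ≤⟨ p ⟩
        seq y n                ≡⟨ ℚ.+-identityʳ _ ⟨
        seq y n ℚ.+ 0ℚ         ≤⟨ ℚ.+-monoʳ-≤ (seq y n) (ℚ.<⇒≤ 0<η) ⟩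
        seq y n ℚ.+ η          ∎) p) x≰y
      where open ℚ.≤-Reasoning

  private
    +-≥0 : ∀ {p q} → 0ℚ ℚ.≤ p → 0ℚ ℚ.≤ q → 0ℚ ℚ.≤ p ℚ.+ q
    +-≥0 0≤p 0≤q = ℚ.+-mono-≤ 0≤p 0≤q

    *-≥0 : ∀ {p q} → 0ℚ ℚ.≤ p → 0ℚ ℚ.≤ q → 0ℚ ℚ.≤ p ℚ.* q
    *-≥0 {p} {q} 0≤p 0≤q = ℚ.nonNegative⁻¹ (p ℚ.* q)
      {{ℚ.nonNeg*nonNeg⇒nonNeg p {{ℚ.nonNegative 0≤p}} q {{ℚ.nonNegative 0≤q}}}}

    -‿≥0 : ∀ {p q} → p ℚ.≤ q → 0ℚ ℚ.≤ q ℚ.- p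
    -‿≥0 {p} {q} p≤q = ≡.subst (ℚ._≤ q ℚ.- p) (ℚ.+-inverseʳ p) (ℚ.+-monoˡ-≤ (ℚ.- p) p≤q)

  -- Terms of nonnegative limits may dip to `- δ`. In each case for the sign of `x`, the claimed
  -- quantity is a sum of three products of nonnegative factors.
  *-nearly-nonNeg : ∀ {x y δ K L} → 0ℚ ℚ.≤ δ → 0ℚ ℚ.≤ x ℚ.+ δ → 0ℚ ℚ.≤ y ℚ.+ δ →
    ∣ x ∣ ℚ.≤ K → ∣ y ∣ ℚ.≤ L → 0ℚ ℚ.≤ x ℚ.* y ℚ.+ (K ℚ.+ L) ℚ.* δ
  *-nearly-nonNeg {x} {y} {δ} {K} {L} 0≤δ 0≤x+δ 0≤y+δ ∣x∣≤K ∣y∣≤L with ℚ.≤-total 0ℚ x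
  ... | inj₁ 0≤x = ≡.subst (0ℚ ℚ.≤_)
    (solve 5 (λ x y δ K L → x :* (y :+ δ) :+ δ :* (K :- x) :+ δ :* L := x :* y :+ (K :+ L) :* δ) ≡.refl x y δ K L)
    (+-≥0 (+-≥0 (*-≥0 0≤x 0≤y+δ) (*-≥0 0≤δ (-‿≥0 (ℚ.≤-trans (p≤∣p∣ x) ∣x∣≤K))))
      (*-≥0 0≤δ (ℚ.≤-trans (ℚ.0≤∣p∣ y) ∣y∣≤L)))
    where open ℚ.+-*-Solver
  ... | inj₂ x≤0 = ≡.subst (0ℚ ℚ.≤_)
    (solve 5 (λ x y δ K L → (con 0ℚ :- x) :* (L :- y) :+ (x :+ δ) :* L :+ δ :* K := x :* y :+ (K :+ L) :* δ) ≡.refl x y δ K L)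
    (+-≥0 (+-≥0 (*-≥0 (-‿≥0 x≤0) (-‿≥0 (ℚ.≤-trans (p≤∣p∣ y) ∣y∣≤L)))
        (*-≥0 0≤x+δ (ℚ.≤-trans (ℚ.0≤∣p∣ y) ∣y∣≤L)))
      (*-≥0 0≤δ (ℚ.≤-trans (ℚ.0≤∣p∣ x) ∣x∣≤K)))
    where open ℚ.+-*-Solver

  *-nonNeg : ∀ {x y} → 0ℝ ≤ x → 0ℝ ≤ y → 0ℝ ≤ x * y
  *-nonNeg {x} {y} 0≤x 0≤y = mk≤ λ ε 0<ε →
    let K , 0<K , x<K = bounded (seq x) (cauchy x)
        L , 0<L , y<L = bounded (seq y) (cauchy y)
        δ , 0<δ , eq  = shrink (ℚ.+-mono-< 0<K 0<L) 0<ε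
    in eventually-map
         (λ n ((p , q) , r , s) → ≡.subst (λ ε → 0ℚ ℚ.≤ seq x n ℚ.* seq y n ℚ.+ ε) eq
           (*-nearly-nonNeg (ℚ.<⇒≤ 0<δ) p q (ℚ.<⇒≤ r) (ℚ.<⇒≤ s)))
         ((below 0≤x δ 0<δ ∧ below 0≤y δ 0<δ) ∧ (x<K ∧ y<L))

  1≉0 : ¬ 1ℝ ≈ 0ℝ
  1≉0 1≈0 with eventually-witness (close 1≈0 1ℚ (ℚ.positive⁻¹ 1ℚ))
  ... | _ , 1<1 = ℚ.<-irrefl ≡.refl 1<1

  -- Made total with value 0 at 0, because finitely many initial terms of a nonzero real may vanish.
  recip : ℚ → ℚ
  recip p with p ℚ.≟ 0ℚ
  ... | yes _  = 0ℚ
  ... | no p≢0 = 1/_ p {{ℚ.≢-nonZero p≢0}}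

  *-recip : ∀ {p} → p ≢ 0ℚ → p ℚ.* recip p ≡ 1ℚ
  *-recip {p} p≢0 with p ℚ.≟ 0ℚ
  ... | yes p≡0 = contradiction p≡0 p≢0
  ... | no p≢0′ = ℚ.*-inverseʳ p {{ℚ.≢-nonZero p≢0′}}

  Apart : ℝ → Set
  Apart x = ∃[ δ ] (0ℚ ℚ.< δ × Eventually λ n → δ ℚ.≤ ∣ seq x n ∣)

  -- Were `x` not apart from 0, comparisons with 0 from both sides would always yield the first
  -- alternative, which forces `x ≈ 0ℝ`.
  ≉0⇒apart : ∀ {x} → ¬ x ≈ 0ℝ → ¬ ¬ Apart x
  ≉0⇒apart {x} x≉0 ¬apart = x≉0 (≤-antisym
    (mk≤ λ ε 0<ε → upper ε (compare x 0ℝ ε 0<ε))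
    (mk≤ λ ε 0<ε → lower ε (compare 0ℝ x ε 0<ε)))
    where
    upper : ∀ ε → Comparison x 0ℝ ε → Eventually λ n → seq x n ℚ.≤ 0ℚ ℚ.+ ε
    upper ε (≲ p)       = p
    upper ε (≫ δ 0<δ p) = contradiction (δ , 0<δ , eventually-map
      (λ n p → ℚ.≤-trans (≡.subst (ℚ._≤ seq x n) (ℚ.+-identityˡ δ) p) (p≤∣p∣ (seq x n))) p) ¬apart
    lower : ∀ ε → Comparison 0ℝ x ε → Eventually λ n → 0ℚ ℚ.≤ seq x n ℚ.+ ε
    lower ε (≲ p)       = p
    lower ε (≫ δ 0<δ p) = contradiction (δ , 0<δ , eventually-map
      (λ n p → begin
        δ                                ≡⟨ solve 2 (λ x δ → δ := x :+ δ :- x) ≡.refl (seq x n) δ ⟩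
        seq x n ℚ.+ δ ℚ.- seq x n        ≤⟨ ℚ.+-monoˡ-≤ (ℚ.- seq x n) p ⟩
        0ℚ ℚ.- seq x n                   ≡⟨ ℚ.+-identityˡ _ ⟩
        ℚ.- seq x n                      ≤⟨ p≤∣p∣ (ℚ.- seq x n) ⟩
        ∣ ℚ.- seq x n ∣                  ≡⟨ ℚ.∣-p∣≡∣p∣ (seq x n) ⟩
        ∣ seq x n ∣                      ∎) p) ¬apart
      where
      open ℚ.≤-Reasoning
      open ℚ.+-*-Solver

  module _ (x : ℝ) {δ : ℚ} {N : ℕ} (0<δ : 0ℚ ℚ.< δ) (δ≤∣x∣ : ∀ n → N ℕ.≤ n → δ ℚ.≤ ∣ seq x n ∣) where

    private
      seq-nonzero : ∀ n → N ℕ.≤ n → seq x n ≢ 0ℚ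
      seq-nonzero n N≤n eq = ℚ.<-irrefl ≡.refl (ℚ.<-≤-trans 0<δ (≡.subst (δ ℚ.≤_) (≡.cong ∣_∣ eq) (δ≤∣x∣ n N≤n)))

    -- The difference of the reciprocals of `p` and `q` is that of `q` and `p` divided by `p * q`,
    -- and the absolute value of the divisor is at least `δ * δ`.
    recip-close : ∀ {ε} m n → N ℕ.≤ m → N ℕ.≤ n → ∣ seq x m ℚ.- seq x n ∣ ℚ.< δ ℚ.* δ ℚ.* ε →
      ∣ recip (seq x m) ℚ.- recip (seq x n) ∣ ℚ.< ε
    recip-close {ε} m n N≤m N≤n close = ℚ.*-cancelˡ-<-nonNeg (δ ℚ.* δ) {{ℚ.nonNegative (*-≥0 (ℚ.<⇒≤ 0<δ) (ℚ.<⇒≤ 0<δ))}} (begin-strict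
      δ ℚ.* δ ℚ.* ∣ r ℚ.- s ∣
        ≤⟨ ℚ.*-monoʳ-≤-nonNeg ∣ r ℚ.- s ∣ {{ℚ.∣-∣-nonNeg (r ℚ.- s)}} (begin
             δ ℚ.* δ               ≤⟨ ℚ.*-monoʳ-≤-nonNeg δ {{ℚ.nonNegative (ℚ.<⇒≤ 0<δ)}} (δ≤∣x∣ m N≤m) ⟩
             ∣ p ∣ ℚ.* δ           ≤⟨ ℚ.*-monoˡ-≤-nonNeg ∣ p ∣ {{ℚ.∣-∣-nonNeg p}} (δ≤∣x∣ n N≤n) ⟩
             ∣ p ∣ ℚ.* ∣ q ∣       ∎) ⟩
      ∣ p ∣ ℚ.* ∣ q ∣ ℚ.* ∣ r ℚ.- s ∣
        ≡⟨ ≡.trans (≡.cong (ℚ._* ∣ r ℚ.- s ∣) (≡.sym (ℚ.∣p*q∣≡∣p∣*∣q∣ p q))) (≡.sym (ℚ.∣p*q∣≡∣p∣*∣q∣ (p ℚ.* q) (r ℚ.- s))) ⟩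
      ∣ p ℚ.* q ℚ.* (r ℚ.- s) ∣
        ≡⟨ ≡.cong ∣_∣ (solve 4 (λ p q r s → p :* q :* (r :- s) := q :* (p :* r) :- p :* (q :* s)) ≡.refl p q r s) ⟩
      ∣ q ℚ.* (p ℚ.* r) ℚ.- p ℚ.* (q ℚ.* s) ∣
        ≡⟨ ≡.cong₂ (λ a b → ∣ q ℚ.* a ℚ.- p ℚ.* b ∣) (*-recip (seq-nonzero m N≤m)) (*-recip (seq-nonzero n N≤n)) ⟩
      ∣ q ℚ.* 1ℚ ℚ.- p ℚ.* 1ℚ ∣
        ≡⟨ ≡.trans (≡.cong₂ (λ a b → ∣ a ℚ.- b ∣) (ℚ.*-identityʳ q) (ℚ.*-identityʳ p)) (≡.sym (ℚ.∣-p∣≡∣p∣ (q ℚ.- p))) ⟩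
      ∣ ℚ.- (q ℚ.- p) ∣
        ≡⟨ ≡.cong ∣_∣ (solve 2 (λ p q → :- (q :- p) := p :- q) ≡.refl p q) ⟩
      ∣ p ℚ.- q ∣
        <⟨ close ⟩
      δ ℚ.* δ ℚ.* ε ∎)
      where
      open ℚ.≤-Reasoning
      open ℚ.+-*-Solver
      p = seq x m
      q = seq x n
      r = recip p
      s = recip q

    reciprocal : ℝ
    reciprocal = mkℝ (λ n → recip (seq x n)) λ ε 0<ε →
      let 0<δδ = ℚ.positive⁻¹ (δ ℚ.* δ) {{ℚ.pos*pos⇒pos δ {{positive 0<δ}} δ {{positive 0<δ}}}}
          M , h = cauchy x (δ ℚ.* δ ℚ.* ε)
            (ℚ.positive⁻¹ (δ ℚ.* δ ℚ.* ε) {{ℚ.pos*pos⇒pos (δ ℚ.* δ) {{positive 0<δδ}} ε {{positive 0<ε}}}})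
      in N ℕ.⊔ M , λ m n ≤m ≤n →
        recip-close m n (ℕ.m⊔n≤o⇒m≤o N M ≤m) (ℕ.m⊔n≤o⇒m≤o N M ≤n)
          (h m n (ℕ.m⊔n≤o⇒n≤o N M ≤m) (ℕ.m⊔n≤o⇒n≤o N M ≤n))

    *-reciprocal : x * reciprocal ≈ 1ℝ
    *-reciprocal = mk≈ λ ε 0<ε → N , λ n N≤n → ≡.subst (ℚ._< ε)
      (≡.cong ∣_∣ (≡.sym (≡.cong (ℚ._- 1ℚ) (*-recip (seq-nonzero n N≤n))))) 0<ε

  inverse : ∀ {x} → ¬ x ≈ 0ℝ → ¬ ¬ (∃[ y ] x * y ≈ 1ℝ)
  inverse {x} x≉0 = do
    (δ , 0<δ , N , δ≤∣x∣) ← ≉0⇒apart x≉0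
    return (reciprocal x 0<δ δ≤∣x∣ , *-reciprocal x 0<δ δ≤∣x∣)

  ℝ-orderedField : OrderedField
  ℝ-orderedField = record
    { commutativeRing = record { isCommutativeRing = ℝ-isCommutativeRing }
    ; _≤_         = _≤_
    ; ≤-reflexive = ≈⇒≤
    ; ≤-trans     = ≤-trans
    ; ≤-antisym   = ≤-antisym
    ; +-monoʳ-≤   = +-monoʳ-≤
    ; *-nonNeg    = *-nonNeg
    ; ≤-stable    = ≤-stable
    ; ≰⇒≥         = ≰⇒≥
    ; inverse     = inverse
    ; 1≉0         = 1≉0
    ; fromℚ       = record
      { ⟦_⟧    = λ p → mkℝ (λ _ → p) (const-cauchy p)
      ; +-homo = λ _ _ → pointwise λ _ → ≡.refl
      ; *-homo = λ _ _ → pointwise λ _ → ≡.refl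
      ; -‿homo = λ _ → pointwise λ _ → ≡.refl
      ; 0-homo = ≈-refl
      ; 1-homo = ≈-refl
      }
    }

-- Real polytopes with prescribed facet directions

open Defs
open Reals using (ℝ-orderedField)
open Linear ℝ-orderedField using (nonzero-coordinate; hyperplane-dependent)
open Farkas ℝ-orderedField using (Constraint; Sat)
open Separation ℝ-orderedField using (NonZeroVector)
open Polyhedra ℝ-orderedField
  using (Represents; represents; Parallel; interior-point; parallel-representation; module IntersectionGraphs)

module _ {d k : ℕ} (L : Fin k → PointSet (suc d)) (hyperplane : ∀ i → IsLinearHyperplane (L i)) where

  normal : Fin k → ℝ^ (suc d)
  normal i = proj₁ (hyperplane i)

  normal≉0 : ∀ i → NonZeroVector (normal i)
  normal≉0 i = proj₁ (proj₂ (hyperplane i))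

  -- The points show that the face cut out by `a` has dimension at least `d`, and lying in a
  -- hyperplane it has no more. It is therefore a facet, to which the hypothesis on facet directions
  -- applies.
  facet-parallel : ∀ {P} → 𝒫 L P → ∀ a b (p : Fin (suc d) → ℝ^ (suc d)) → ¬ IsZero a →
    (∀ {x} → P x → a · x ≤ b) → AffinelyIndependent p → (∀ j → P (p j)) → (∀ j → a · p j ≈ b) →
    ∃[ i ] (∀ j l → normal i · (p j ⊖ p l) ≈ 0ℝ)
  facet-parallel {P} (_ , _ , facets) a b p a≉0 P≤ independent p∈P on =
    let i , F∥Lᵢ = facets F ((a , b , P≤ , id , id) , dimension)
    in i , λ j l → proj₁ (proj₂ (proj₂ (hyperplane i))) (F∥Lᵢ (p∈P j , on j) (p∈P l , on l))
    where
    F : PointSet (suc d)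
    F x = P x × a · x ≈ b
    dimension : HasDimension F d
    dimension = (p , (λ j → p∈P j , on j) , independent) , λ q q∈F q-independent →
      nonzero-coordinate a a≉0 λ (i , aᵢ≉0) →
        hyperplane-dependent {a = a} {i} aᵢ≉0 q (proj₂ ∘ q∈F) q-independent

  -- Full dimension supplies the independent points behind the interior point; all given halfspaces
  -- then start out as pending constraints.
  polytope-representation : ∀ {P} → 𝒫 L P →
    ¬ ¬ (∃[ cs ] (Represents normal normal≉0 P cs × All (Parallel normal normal≉0) cs))
  polytope-representation {P} P∈𝒫@(((m , S , halfspace , P≐⋂) , _) , ((p , p∈P , independent) , _) , _) = do
    (z , strict) ← interior-point p independent cs nonzero λ j → sound (p∈P j)
    parallel-representation normal normal≉0
      (λ a b p a≉0 P≤ independent p∈P on → return (facet-parallel P∈𝒫 a b p a≉0 P≤ independent p∈P on))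
      {z} [] cs (represents sound complete) strict [] nonzero
    where
    constraint : Fin m → Constraint (suc d)
    constraint j = proj₁ (halfspace j) , proj₁ (proj₂ (halfspace j))
    cs : List (Constraint (suc d))
    cs = List.tabulate constraint
    nonzero : All (NonZeroVector ∘ proj₁) cs
    nonzero = All.tabulate⁺ {f = constraint} λ j → proj₁ (proj₂ (proj₂ (halfspace j)))
    sound : ∀ {x} → P x → All (Sat x) cs
    sound x∈P = All.tabulate⁺ {f = constraint} λ j →
      proj₁ (proj₂ (proj₂ (proj₂ (halfspace j)))) (proj₁ P≐⋂ x∈P j)
    complete : ∀ {x} → All (Sat x) cs → P x
    complete sat = proj₂ P≐⋂ λ j → proj₂ (proj₂ (proj₂ (proj₂ (halfspace j)))) (All.tabulate⁻ {f = constraint} sat j)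

theorem9 : (d k n : ℕ) → .{{_ : NonZero d}} → .{{_ : NonZero k}} → .{{_ : NonZero n}} →
    (G : Graph n) → k-DIR-CONV G d k →
    (Cs : List (Subset n)) → Unique Cs → All (IsMaximalClique G) Cs →
    length Cs ≤ℕ n ^ (d *ℕ k ^ (d +ℕ 1))
theorem9 zero k n = contradiction ≡.refl (ℕ.≢-nonZero⁻¹ 0)
theorem9 (suc d) k zero = contradiction ≡.refl (ℕ.≢-nonZero⁻¹ 0)
theorem9 (suc d) k (suc n) G (L , hyperplane , _ , R , R∈𝒫 , intersection) =
  IntersectionGraphs.maximalCliques-bound (normal L hyperplane) (normal≉0 L hyperplane) G R
    -- The points that witness full dimension also witness nonemptiness.
    (λ v → let _ , ((p , p∈ , _) , _) , _ = R∈𝒫 v in p zero , p∈ zero)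
    (λ v → polytope-representation L hyperplane (R∈𝒫 v))
    intersection
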